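{- Let $k\ge 3$ be an integer. There exist infinitely many (pairwise non-isomorphic) finite minimal asymmetric $k$-graphs which have maximum degree $2$ and maximum codegree $1$.
   Context: For $k\ge 2$, a $k$-graph ($k$-uniform hypergraph) is a pair $\mathcal{G}=(\mathcal{V}(\mathcal{G}),\mathcal{E}(\mathcal{G}))$ where the edge set $\mathcal{E}(\mathcal{G})$ is a set of $k$-element subsets of the finite vertex set $\mathcal{V}(\mathcal{G})$. An automorphism on a $k$-graph $\mathcal{G}=(\mathcal{V},\mathcal{E})$ is a bijection $\phi\colon\mathcal{V}\to\mathcal{V}$ such that for every $E\in\mathcal{E}$, $\{\phi(v): v\in E\}\in\mathcal{E}$. It is non-trivial if it is not the identity. $\mathcal{G}$ is symmetric if there exists a non-trivial automorphism on $\mathcal{G}$, and asymmetric otherwise. For $W\subseteq\mathcal{V}(\mathcal{G})$, the sub-hypergraph of $\mathcal{G}$ induced by $W$ has vertex set $W$ and edge set $\{E\in\mathcal{E}(\mathcal{G}): E\subseteq W\}$. $\mathcal{G}$ is minimal asymmetric if it is asymmetric and every induced sub-hypergraph $\mathcal{H}$ of $\mathcal{G}$ with $2\le|\mathcal{V}(\mathcal{H})|<|\mathcal{V}(\mathcal{G})|$ is symmetric. The degree of a vertex is the number of edges containing it; the maximum degree of $\mathcal{G}$ is the maximum over all vertices. The codegree of two distinct vertices $u,v$ is the number of edges containing both $u$ and $v$; the maximum codegree of $\mathcal{G}$ is the maximum of the codegrees over all pairs of distinct vertices. -}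

module Defs where

open import Data.Fin.Base using (Fin)
open import Data.Fin.Properties using (_≟_)
open import Data.Fin.Subset using (Subset; _∈_; _⊆_; ∣_∣)
open import Data.Fin.Subset.Properties using (_∈?_; _⊆?_)
open import Data.List.Base using (List; allFin; cartesianProduct; filter; length; map)
open import Data.List.Extrema.Nat using (max)
import Data.List.Membership.Propositional as List
open import Data.List.Membership.Propositional.Properties using (∈-filter⁻)
open import Data.List.Relation.Unary.Unique.Propositional using (Unique)
open import Data.List.Relation.Unary.Unique.Propositional.Properties using (filter⁺)
open import Data.Nat.Base using (ℕ; _≤_; _<_)
open import Data.Product.Base using (Σ; ∃; ∃-syntax; _×_; _,_; proj₁; proj₂)
open import Function.Bundles using (_⇔_; _⤖_; Bijection)
open import Relation.Binary.PropositionalEquality using (_≡_)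
open import Relation.Nullary.Decidable using (¬?; _×-dec_)
open import Relation.Nullary.Negation using (¬_)

-- The vertex set is a subset of an ambient Fin size, rather than all of it,
-- so that an induced sub-hypergraph needs no relabelling of its vertices.
-- A duplicate-free list represents the edge set; its order is irrelevant to
-- all the notions below.
record KGraph (k : ℕ) : Set where
  field
    size         : ℕ
    vertices     : Subset size
    edges        : List (Subset size)
    edges-unique : Unique edges
    edge⊆        : ∀ {E} → E List.∈ edges → E ⊆ vertices
    edge-card    : ∀ {E} → E List.∈ edges → ∣ E ∣ ≡ k

  order : ℕ
  order = ∣ vertices ∣

  Vertex : Set
  Vertex = ∃[ v ] v ∈ vertices

  vertexList : List (Fin size)
  vertexList = filter (_∈? vertices) (allFin size)

  degree : Fin size → ℕ
  degree v = length (filter (v ∈?_) edges)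

  codegree : Fin size → Fin size → ℕ
  codegree u v = length (filter (λ E → (u ∈? E) ×-dec (v ∈? E)) edges)

  distinctPairs : List (Fin size × Fin size)
  distinctPairs =
    filter (λ (u , v) → ¬? (u ≟ v)) (cartesianProduct vertexList vertexList)

  -- The maximum of an empty family is taken to be 0.
  maxDegree : ℕ
  maxDegree = max 0 (map degree vertexList)

  maxCodegree : ℕ
  maxCodegree = max 0 (map (λ (u , v) → codegree u v) distinctPairs)

open KGraph

-- F = { φ(v) : v ∈ E }
IsImage : ∀ {k} (G H : KGraph k) → (Vertex G → Vertex H) →
          Subset (size G) → Subset (size H) → Set
IsImage G H φ E F =
  ∀ w → w ∈ F ⇔ (Σ (Vertex G) λ v → proj₁ v ∈ E × proj₁ (φ v) ≡ w)

-- { φ(v) : v ∈ E } is an edge of H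
ImageIsEdge : ∀ {k} (G H : KGraph k) → (Vertex G → Vertex H) →
              Subset (size G) → Set
ImageIsEdge G H φ E = ∃[ F ] F List.∈ edges H × IsImage G H φ E F

Isomorphic : ∀ {k} → KGraph k → KGraph k → Set
Isomorphic G H =
  Σ (Vertex G ⤖ Vertex H) λ φ →
    ∀ E → E ⊆ vertices G → E List.∈ edges G ⇔ ImageIsEdge G H (Bijection.to φ) E

IsAutomorphism : ∀ {k} (G : KGraph k) → Vertex G ⤖ Vertex G → Set
IsAutomorphism G φ =
  ∀ E → E List.∈ edges G → ImageIsEdge G G (Bijection.to φ) E

NonTrivial : ∀ {k} (G : KGraph k) → Vertex G ⤖ Vertex G → Set
NonTrivial G φ = ¬ (∀ v → Bijection.to φ v ≡ v)

Symmetric : ∀ {k} → KGraph k → Set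
Symmetric G = Σ (Vertex G ⤖ Vertex G) λ φ → IsAutomorphism G φ × NonTrivial G φ

Asymmetric : ∀ {k} → KGraph k → Set
Asymmetric G = ¬ Symmetric G

induced : ∀ {k} (G : KGraph k) → Subset (size G) → KGraph k
induced G W = record
  { size         = size G
  ; vertices     = W
  ; edges        = filter (_⊆? W) (edges G)
  ; edges-unique = filter⁺ (_⊆? W) (edges-unique G)
  ; edge⊆        = λ E∈ → proj₂ (∈-filter⁻ (_⊆? W) {xs = edges G} E∈)
  ; edge-card    = λ E∈ → edge-card G (proj₁ (∈-filter⁻ (_⊆? W) E∈))
  }

MinimalAsymmetric : ∀ {k} → KGraph k → Set
MinimalAsymmetric G =
  Asymmetric G ×
  (∀ W → W ⊆ vertices G →
     2 ≤ order (induced G W) → order (induced G W) < order G →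
     Symmetric (induced G W))

{-# OPTIONS --safe #-}
module Submission where

-- A k-graph of maximum degree 2 and codegree 1 is dual to a graph Γ, loops allowed, in which every
-- vertex u has exactly k neighbours: u becomes the hyperedge of all items {u , v} with u ~ v, and a
-- loop at u becomes a vertex of degree 1. The vertices of Γ are the (t , i) with t cyclic of length
-- m = 7 + r and i < k − 2. Consecutive layers are joined by the half graph (t , i) ~ (t + 1 , j)
-- for i ≤ j, all vertices are looped except (0 , 0), (2 , 0) and (1 , 0), (4 , 0), and those are
-- joined in pairs instead.
--
-- Asymmetry: the four unlooped vertices and the looped vertex (3 , 0) are singled out by their
-- adjacencies, hence layers 4 and 5 are preserved; the half graph between them admits no shift, so
-- they are fixed pointwise, and each layer then determines the next.
--
-- Minimality: let S be the set of hyperedges contained in W. If two items of W lie in the same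
-- members of S, exchange them. Otherwise every u ∈ S sees at most one item of W private to it, so
-- that a vertex leaves S once it has a neighbour outside S (looped) or two of them (unlooped). For
-- k ≥ 4 this spreads from any missing vertex to all of Γ. For k = 3, Γ is a cycle with two crossing
-- chords, and each S other than ∅ and V has a reflection, which lifts to W.

open import Defs
open import Data.Nat.Base using (ℕ; zero; suc; _≤_; _<_; _≥_; z≤n; s≤s; s≤s⁻¹; _+_; _*_)
import Data.Fin.Base as Fin
import Data.Nat.Properties as ℕ
open import Data.Product.Base using (Σ; ∃; _×_; _,_; proj₁; proj₂)
open import Data.Sum.Base using (_⊎_; inj₁; inj₂; [_,_]′) renaming (map to map⊎)
open import Data.Bool.Base using (true; false)
open import Data.Fin.Base using (Fin; zero; suc; combine; toℕ; punchOut; inject₁; fromℕ; opposite)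
open import Data.Fin.Properties as Fin using (any?; all?)
open import Data.Fin.Patterns using (0F; 1F; 2F; 3F; 4F; 5F)
open import Data.Fin.Induction using (<-weakInduction; >-weakInduction; <-weakInduction-startingFrom)
open import Data.Fin.Relation.Unary.Top using (view; ‵fromℕ; ‵inject₁; view-fromℕ; view-inject₁)
open import Data.Fin.Subset using (Subset; _∈_; _∉_; _⊆_; ∣_∣; _-_; ⁅_⁆)
open import Data.Fin.Subset.Properties
  using (_∈?_; _⊆?_; Empty-unique; ∣⊥∣≡0; p─⊥≡p; p─q⊆p; x∈p∧x≢y⇒x∈p-y;
         x∈⁅x⁆; ∣⁅x⁆∣≡1; p⊆q⇒∣p∣≤∣q∣; nonempty?; ⊆-reflexive)
open import Data.Vec.Base using ([]; _∷_; tabulate; here; there)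
open import Data.Vec.Properties using (lookup∘tabulate; []=⇒lookup; lookup⇒[]=)
open import Data.Vec.Properties.WithK using ([]=-irrelevant)
open import Data.List.Base as List using (List; []; _∷_; length; filter; allFin)
import Data.List.Membership.Propositional as List
open import Data.List.Membership.Propositional.Properties
  using (∈-filter⁻; ∈-filter⁺; ∈-map⁺; ∈-map⁻; ∈-allFin; ∈-cartesianProduct⁺)
open import Data.List.Extrema.Nat using (max; max≤v⁺; v≤max⁺)
open import Data.List.Relation.Unary.All as All using (All; []; _∷_)
open import Data.List.Relation.Unary.Any using (here; there)
open import Data.List.Relation.Unary.AllPairs using ([]; _∷_)
open import Data.List.Relation.Unary.Unique.Propositional using (Unique)
open import Data.List.Relation.Unary.Unique.Propositional.Properties as Unique using (allFin⁺)
open import Function.Base using (_∘_; id)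
open import Function.Bundles using (_↔_; _⤖_; mk⇔; mk⤖; Equivalence; Inverse; Bijection)
open import Function.Definitions using (Injective)
open import Relation.Binary.PropositionalEquality
  using (_≡_; _≢_; refl; sym; trans; cong; subst)
open import Relation.Nullary.Decidable
  using (Dec; yes; no; does; map′; ¬?; _×-dec_; _⊎-dec_; _→-dec_; decidable-stable)
open import Relation.Nullary.Negation using (¬_; contradiction)
open import Relation.Unary using (Decidable)

open KGraph

-- Cardinalities of finite subsets and of duplicate-free lists.

∣p-x∣ : ∀ {n} {p : Subset n} {x} → x ∈ p → ∣ p ∣ ≡ suc ∣ p - x ∣
∣p-x∣ {p = _ ∷ p} here = cong (suc ∘ ∣_∣) (sym (p─⊥≡p p))
∣p-x∣ {p = true  ∷ p} (there x∈p) = cong suc (∣p-x∣ x∈p)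
∣p-x∣ {p = false ∷ p} (there x∈p) = ∣p-x∣ x∈p

x∉p-x : ∀ {n} {p : Subset n} x → x ∉ p - x
x∉p-x {p = true  ∷ p} zero ()
x∉p-x {p = false ∷ p} zero ()
x∉p-x {p = _ ∷ p} (suc x) (there x∈) = x∉p-x x x∈

enumeration⇒∣p∣≡k : ∀ {n k} (p : Subset n) (f : Fin k → Fin n) → Injective _≡_ _≡_ f →
                    (∀ s → f s ∈ p) → (∀ {x} → x ∈ p → ∃ λ s → f s ≡ x) → ∣ p ∣ ≡ k
enumeration⇒∣p∣≡k {n} {zero} p f inj f∈ surj
  rewrite Empty-unique {p = p} (λ (x , x∈p) → Fin.¬Fin0 (proj₁ (surj x∈p))) = ∣⊥∣≡0 n
enumeration⇒∣p∣≡k {n} {suc k} p f inj f∈ surj =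
  trans (∣p-x∣ (f∈ zero)) (cong suc (enumeration⇒∣p∣≡k (p - f zero) (f ∘ suc)
    (Fin.suc-injective ∘ inj)
    (λ s → x∈p∧x≢y⇒x∈p-y (f∈ (suc s)) (Fin.0≢1+n ∘ sym ∘ inj))
    surj′))
  where
  surj′ : ∀ {x} → x ∈ p - f zero → ∃ λ s → f (suc s) ≡ x
  surj′ {x} x∈ with surj (p─q⊆p p _ x∈)
  ... | zero  , refl = contradiction x∈ (x∉p-x {p = p} x)
  ... | suc s , eq   = s , eq

∣p∣≤1 : ∀ {n} (p : Subset n) → (∀ {x y} → x ∈ p → y ∈ p → x ≡ y) → ∣ p ∣ ≤ 1
∣p∣≤1 {n} p unique with nonempty? p
... | yes (x , x∈p) = subst (∣ p ∣ ≤_) (∣⁅x⁆∣≡1 x)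
                        (p⊆q⇒∣p∣≤∣q∣ λ y∈p → subst (_∈ ⁅ x ⁆) (unique x∈p y∈p) (x∈⁅x⁆ x))
... | no  ¬ne rewrite Empty-unique {p = p} ¬ne | ∣⊥∣≡0 n = z≤n

-- If `y` were missed, punching it out would inject a finite set into a smaller one.
injective⇒surjective : ∀ {n} {f : Fin n → Fin n} → Injective _≡_ _≡_ f → ∀ y → ∃ λ x → f x ≡ y
injective⇒surjective {suc n} {f} inj y with any? (λ x → f x Fin.≟ y)
... | yes p = p
... | no ¬p = contradiction (Fin.injective⇒≤ {f = λ x → punchOut (y≢f x)}
                 (λ {x} {x′} → inj ∘ Fin.punchOut-injective (y≢f x) (y≢f x′))) ℕ.1+n≰n
  where
  y≢f : ∀ x → y ≢ f x
  y≢f x y≡fx = ¬p (x , sym y≡fx)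

module _ {n} {P : Fin n → Set} (P? : Decidable P) where

  abstract
    comprehension : Subset n
    comprehension = tabulate (does ∘ P?)

    ∈-comprehension⁺ : ∀ {x} → P x → x ∈ comprehension
    ∈-comprehension⁺ {x} px = lookup⇒[]= x _ (trans (lookup∘tabulate _ x) (lem (P? x)))
      where
      lem : (d : Dec (P x)) → does d ≡ true
      lem (yes _)  = refl
      lem (no ¬px) = contradiction px ¬px

    ∈-comprehension⁻ : ∀ {x} → x ∈ comprehension → P x
    ∈-comprehension⁻ {x} x∈ = lem (P? x) (trans (sym (lookup∘tabulate _ x)) ([]=⇒lookup x∈))
      where
      lem : (d : Dec (P x)) → does d ≡ true → P x
      lem (yes px) _ = px

module _ {A : Set} where

  length≤1 : ∀ {xs : List A} → Unique xs → (∀ {x y} → x List.∈ xs → y List.∈ xs → x ≡ y) →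
             length xs ≤ 1
  length≤1 {[]}         _                 _  = z≤n
  length≤1 {_ ∷ []}     _                 _  = s≤s z≤n
  length≤1 {_ ∷ _ ∷ _} ((x≢y ∷ _) ∷ _)   eq = contradiction (eq (here refl) (there (here refl))) x≢y

  length≤2 : ∀ {xs : List A} {a b} → Unique xs → (∀ {x} → x List.∈ xs → x ≡ a ⊎ x ≡ b) →
             length xs ≤ 2
  length≤2 {[]}            _ _ = z≤n
  length≤2 {_ ∷ []}        _ _ = s≤s z≤n
  length≤2 {_ ∷ _ ∷ []}    _ _ = s≤s (s≤s z≤n)
  length≤2 {_ ∷ _ ∷ _ ∷ _} ((x≢y ∷ x≢z ∷ _) ∷ (y≢z ∷ _) ∷ _) f
    with f (here refl) | f (there (here refl)) | f (there (there (here refl)))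
  ... | inj₁ refl | inj₁ refl | _         = contradiction refl x≢y
  ... | inj₁ refl | inj₂ refl | inj₁ refl = contradiction refl x≢z
  ... | inj₁ refl | inj₂ refl | inj₂ refl = contradiction refl y≢z
  ... | inj₂ refl | inj₂ refl | _         = contradiction refl x≢y
  ... | inj₂ refl | inj₁ refl | inj₂ refl = contradiction refl x≢z
  ... | inj₂ refl | inj₁ refl | inj₁ refl = contradiction refl y≢z

  1≤length : ∀ {xs : List A} {x} → x List.∈ xs → 1 ≤ length xs
  1≤length (here _)  = s≤s z≤n
  1≤length (there _) = s≤s z≤n

  2≤length : ∀ {xs : List A} {x y} → x ≢ y → x List.∈ xs → y List.∈ xs → 2 ≤ length xs
  2≤length x≢y (here refl) (here refl) = contradiction refl x≢y
  2≤length _   (here _)    (there y∈)  = s≤s (1≤length y∈)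
  2≤length _   (there x∈)  _           = s≤s (1≤length x∈)

  max-map≡ : ∀ (f : A → ℕ) {xs : List A} {n} → (∀ {x} → x List.∈ xs → f x ≤ n) →
             (∃ λ x → x List.∈ xs × n ≤ f x) → max 0 (List.map f xs) ≡ n
  max-map≡ f {xs} {n} f≤n (x , x∈ , n≤fx) = ℕ.≤-antisym
    (max≤v⁺ z≤n (All.tabulate λ y∈ → let (z , z∈ , eq) = ∈-map⁻ f y∈ in subst (_≤ n) (sym eq) (f≤n z∈)))
    (v≤max⁺ 0 _ (inj₂ (List.lose (∈-map⁺ f x∈) n≤fx)))

-- Regular graphs with loops and their dual hypergraphs.

abstract
  -- The unordered pair {i , j}, encoded as i ≤ j.
  pair : ∀ {n} → Fin n → Fin n → Fin (n * n)
  pair i j with Fin.≤-total i j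
  ... | inj₁ _ = combine i j
  ... | inj₂ _ = combine j i

  pair-comm : ∀ {n} (i j : Fin n) → pair i j ≡ pair j i
  pair-comm i j with Fin.≤-total i j | Fin.≤-total j i
  ... | inj₁ i≤j | inj₁ j≤i rewrite Fin.≤-antisym i≤j j≤i = refl
  ... | inj₁ _   | inj₂ _   = refl
  ... | inj₂ _   | inj₁ _   = refl
  ... | inj₂ j≤i | inj₂ i≤j rewrite Fin.≤-antisym i≤j j≤i = refl

  pair-injective : ∀ {n} (i j k l : Fin n) → pair i j ≡ pair k l → (i ≡ k × j ≡ l) ⊎ (i ≡ l × j ≡ k)
  pair-injective i j k l eq with Fin.≤-total i j | Fin.≤-total k l
  ... | inj₁ _ | inj₁ _ = inj₁ (Fin.combine-injective i j k l eq)
  ... | inj₁ _ | inj₂ _ = inj₂ (Fin.combine-injective i j l k eq)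
  ... | inj₂ _ | inj₁ _ = let (p , q) = Fin.combine-injective j i k l eq in inj₂ (q , p)
  ... | inj₂ _ | inj₂ _ = let (p , q) = Fin.combine-injective j i l k eq in inj₁ (q , p)

-- A loop counts as a single neighbour. `nb` lists the neighbours of a vertex without repetition, so
-- `Adj` is regular of degree `k`.
record RegularGraph (k : ℕ) : Set₁ where
  field
    V            : Set
    N            : ℕ
    enum         : Fin N ↔ V
    Adj          : V → V → Set
    nb           : V → Fin k → V
    nb-injective : ∀ u → Injective _≡_ _≡_ (nb u)
    nb-adj       : ∀ u s → Adj u (nb u s)
    adj-nb       : ∀ {u v} → Adj u v → ∃ λ s → nb u s ≡ v
    adj-sym      : ∀ {u v} → Adj u v → Adj v u

module Dual {κ} (Γ : RegularGraph (2 + κ)) where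
  open RegularGraph Γ public

  k : ℕ
  k = 2 + κ

  code : V → Fin N
  code = Inverse.from enum

  code-injective : Injective _≡_ _≡_ code
  code-injective {u} {v} eq =
    trans (sym (Inverse.strictlyInverseˡ enum u))
          (trans (cong (Inverse.to enum) eq) (Inverse.strictlyInverseˡ enum v))

  _≟ᵥ_ : (u v : V) → Dec (u ≡ v)
  u ≟ᵥ v = map′ code-injective (cong code) (code u Fin.≟ code v)

  module _ {P : V → Set} (P? : Decidable P) where

    anyᵥ? : Dec (∃ P)
    anyᵥ? = map′ (λ (i , p) → Inverse.to enum i , p)
                 (λ (v , p) → code v , subst P (sym (Inverse.strictlyInverseˡ enum v)) p)
                 (any? (P? ∘ Inverse.to enum))

    allᵥ? : Dec (∀ v → P v)
    allᵥ? = map′ (λ p v → subst P (Inverse.strictlyInverseˡ enum v) (p (code v)))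
                 (λ p i → p (Inverse.to enum i))
                 (all? (P? ∘ Inverse.to enum))

  injectiveᵥ⇒surjective : ∀ {f : V → V} → Injective _≡_ _≡_ f → ∀ v → ∃ λ u → f u ≡ v
  injectiveᵥ⇒surjective {f} inj v =
    let (i , eq) = injective⇒surjective {f = code ∘ f ∘ Inverse.to enum} inj′ (code v)
    in Inverse.to enum i , code-injective eq
    where
    inj′ : Injective _≡_ _≡_ (code ∘ f ∘ Inverse.to enum)
    inj′ {x} {y} eq = trans (sym (Inverse.strictlyInverseʳ enum x))
      (trans (cong code (inj (code-injective eq))) (Inverse.strictlyInverseʳ enum y))

  M : ℕ
  M = N * N

  -- The ambient set codes all unordered pairs; only those lying in some `E u`, that is, the edges
  -- and loops of the graph, become vertices of `G`.
  item : V → V → Fin M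
  item u v = pair (code u) (code v)

  item-comm : ∀ u v → item u v ≡ item v u
  item-comm u v = pair-comm (code u) (code v)

  item-injective : ∀ {u v u′ v′} → item u v ≡ item u′ v′ → (u ≡ u′ × v ≡ v′) ⊎ (u ≡ v′ × v ≡ u′)
  item-injective eq with pair-injective _ _ _ _ eq
  ... | inj₁ (p , q) = inj₁ (code-injective p , code-injective q)
  ... | inj₂ (p , q) = inj₂ (code-injective p , code-injective q)

  item-injectiveʳ : ∀ {u v w} → item u v ≡ item u w → v ≡ w
  item-injectiveʳ eq with item-injective eq
  ... | inj₁ (_ , v≡w)   = v≡w
  ... | inj₂ (u≡w , v≡u) = trans v≡u u≡w

  abstract
    E? : ∀ u → Decidable (λ x → ∃ λ s → item u (nb u s) ≡ x)
    E? u x = any? λ s → item u (nb u s) Fin.≟ x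

    E : V → Subset M
    E u = comprehension (E? u)

    item∈E : ∀ {u v} → Adj u v → item u v ∈ E u
    item∈E {u} a = let (s , eq) = adj-nb a in ∈-comprehension⁺ (E? u) (s , cong (item u) eq)

    ∈E⇒nb : ∀ {u x} → x ∈ E u → ∃ λ s → item u (nb u s) ≡ x
    ∈E⇒nb {u} = ∈-comprehension⁻ (E? u)

  item∈Eʳ : ∀ {u v} → Adj u v → item u v ∈ E v
  item∈Eʳ {u} {v} a = subst (_∈ E v) (item-comm v u) (item∈E (adj-sym a))

  ∈E⁻ : ∀ {u x} → x ∈ E u → ∃ λ v → Adj u v × item u v ≡ x
  ∈E⁻ {u} x∈ = let (s , eq) = ∈E⇒nb x∈ in nb u s , nb-adj u s , eq

  item∈E⁻ : ∀ {u v w} → item u v ∈ E w → w ≡ u ⊎ w ≡ v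
  item∈E⁻ {u} {v} {w} x∈ with ∈E⁻ x∈
  ... | z , _ , eq with item-injective eq
  ... | inj₁ (p , _) = inj₁ p
  ... | inj₂ (p , _) = inj₂ p

  -- An item of two distinct hyperedges can only be the one joining their indices. This bounds the
  -- codegree by 1 and lets adjacency be read off from intersections.
  linear : ∀ {u v x} → u ≢ v → x ∈ E u → x ∈ E v → Adj u v × item u v ≡ x
  linear {u} {v} {x} u≢v x∈u x∈v with ∈E⁻ x∈u
  ... | w , a , refl with item∈E⁻ x∈v
  ... | inj₁ v≡u  = contradiction (sym v≡u) u≢v
  ... | inj₂ refl = a , refl

  -- For `u ≢ v` every item of `E u` would have to be `item u v`, but `u` has at least two
  -- neighbours.
  E-⊆-injective : ∀ {u v} → E u ⊆ E v → u ≡ v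
  E-⊆-injective {u} {v} Eu⊆Ev with u ≟ᵥ v
  ... | yes u≡v = u≡v
  ... | no  u≢v = contradiction
    (nb-injective u (item-injectiveʳ (trans (sym (via zero)) (via (suc zero))))) λ ()
    where
    via : ∀ s → item u v ≡ item u (nb u s)
    via s = let x∈ = item∈E (nb-adj u s) in proj₂ (linear u≢v x∈ (Eu⊆Ev x∈))

  E-card : ∀ u → ∣ E u ∣ ≡ k
  E-card u = enumeration⇒∣p∣≡k (E u) (item u ∘ nb u) (nb-injective u ∘ item-injectiveʳ)
    (item∈E ∘ nb-adj u) ∈E⇒nb

  covered? : Decidable (λ x → ∃ λ u → x ∈ E u)
  covered? x = anyᵥ? λ u → x ∈? E u

  edgeList : List (Subset M)
  edgeList = List.map (E ∘ Inverse.to enum) (allFin N)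

  abstract
    ∈edgeList⁺ : ∀ u → E u List.∈ edgeList
    ∈edgeList⁺ u = subst (λ v → E v List.∈ edgeList) (Inverse.strictlyInverseˡ enum u)
      (∈-map⁺ (E ∘ Inverse.to enum) (∈-allFin (code u)))

    ∈edgeList⁻ : ∀ {F} → F List.∈ edgeList → ∃ λ u → F ≡ E u
    ∈edgeList⁻ F∈ = let (i , _ , eq) = ∈-map⁻ (E ∘ Inverse.to enum) F∈ in Inverse.to enum i , eq

    edgeList-unique : Unique edgeList
    edgeList-unique = Unique.map⁺ (λ {i} {j} eq →
        trans (sym (Inverse.strictlyInverseʳ enum i))
          (trans (cong code (E-⊆-injective λ x∈ → subst (_ ∈_) eq x∈)) (Inverse.strictlyInverseʳ enum j)))
        (allFin⁺ N)

    edgeList-⊆ : ∀ {F} → F List.∈ edgeList → F ⊆ comprehension covered?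
    edgeList-⊆ F∈ x∈ = let (u , eq) = ∈edgeList⁻ F∈ in
      ∈-comprehension⁺ covered? (u , subst (_ ∈_) eq x∈)

    edgeList-card : ∀ {F} → F List.∈ edgeList → ∣ F ∣ ≡ k
    edgeList-card F∈ = let (u , eq) = ∈edgeList⁻ F∈ in trans (cong ∣_∣ eq) (E-card u)

  G : KGraph k
  G = record
    { size         = M
    ; vertices     = comprehension covered?
    ; edges        = edgeList
    ; edges-unique = edgeList-unique
    ; edge⊆        = edgeList-⊆
    ; edge-card    = edgeList-card
    }

  E⊆vertices : ∀ u → E u ⊆ vertices G
  E⊆vertices u = edge⊆ G (∈edgeList⁺ u)

  ∈vertexList : ∀ {u x} → x ∈ E u → x List.∈ vertexList G
  ∈vertexList {u} {x} x∈ = ∈-filter⁺ (_∈? vertices G) (∈-allFin x) (E⊆vertices u x∈)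

  -- The first two neighbours cannot both equal `u`. The item of a loop has degree 1, so degree 2
  -- must be witnessed by a proper edge.
  other-neighbour : ∀ u → ∃ λ v → Adj u v × u ≢ v
  other-neighbour u with u ≟ᵥ nb u zero
  ... | no  u≢ = nb u zero , nb-adj u zero , u≢
  ... | yes u≡ = nb u (suc zero) , nb-adj u (suc zero) ,
                 λ u≡′ → contradiction (nb-injective u (trans (sym u≡) u≡′)) λ ()

  maxDegree≡2 : V → maxDegree G ≡ 2
  maxDegree≡2 u = max-map≡ (degree G) upper
    (item u v , ∈vertexList (item∈E u~v) , 2≤length (u≢v ∘ E-⊆-injective ∘ ⊆-reflexive)
      (at (item∈E u~v)) (at (item∈Eʳ u~v)))
    where
    v = proj₁ (other-neighbour u)
    u~v = proj₁ (proj₂ (other-neighbour u))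
    u≢v = proj₂ (proj₂ (other-neighbour u))
    at : ∀ {w x} → x ∈ E w → E w List.∈ filter (x ∈?_) edgeList
    at {w} x∈ = ∈-filter⁺ (_ ∈?_) (∈edgeList⁺ w) x∈
    upper : ∀ {x} → x List.∈ vertexList G → degree G x ≤ 2
    upper {x} x∈ with ∈-comprehension⁻ covered? (proj₂ (∈-filter⁻ (_∈? vertices G) {xs = allFin M} x∈))
    ... | w , x∈Ew with ∈E⁻ x∈Ew
    ... | z , _ , refl = length≤2 (Unique.filter⁺ (_ ∈?_) (edges-unique G)) λ F∈ →
      let (F∈es , x∈F) = ∈-filter⁻ (_ ∈?_) {xs = edgeList} F∈
          (y , F≡Ey)   = ∈edgeList⁻ F∈es
      in [ (λ y≡w → inj₁ (trans F≡Ey (cong E y≡w))) , (λ y≡z → inj₂ (trans F≡Ey (cong E y≡z))) ]′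
           (item∈E⁻ (subst (item w z ∈_) F≡Ey x∈F))

  maxCodegree≡1 : V → maxCodegree G ≡ 1
  maxCodegree≡1 u = max-map≡ (λ (x , y) → codegree G x y) upper
    ((x₀ , x₁) , ∈-filter⁺ _ (∈-cartesianProduct⁺ (∈vertexList ∈₀) (∈vertexList ∈₁))
                   (λ eq → contradiction (nb-injective u (item-injectiveʳ eq)) λ ())
               , 1≤length (∈-filter⁺ (λ F → (x₀ ∈? F) ×-dec (x₁ ∈? F)) (∈edgeList⁺ u) (∈₀ , ∈₁)))
    where
    x₀ = item u (nb u zero)
    x₁ = item u (nb u (suc zero))
    ∈₀ = item∈E (nb-adj u zero)
    ∈₁ = item∈E (nb-adj u (suc zero))
    upper : ∀ {xy} → xy List.∈ distinctPairs G → codegree G (proj₁ xy) (proj₂ xy) ≤ 1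
    upper {x , y} xy∈ = length≤1 (Unique.filter⁺ both? (edges-unique G)) same
      where
      both? = λ F → (x ∈? F) ×-dec (y ∈? F)
      x≢y : x ≢ y
      x≢y = proj₂ (∈-filter⁻ (λ (u , v) → ¬? (u Fin.≟ v))
              {xs = List.cartesianProduct (vertexList G) (vertexList G)} xy∈)
      same : ∀ {F F′} → F List.∈ filter both? edgeList → F′ List.∈ filter both? edgeList → F ≡ F′
      same F∈ F′∈ with ∈-filter⁻ both? {xs = edgeList} F∈ | ∈-filter⁻ both? {xs = edgeList} F′∈
      ... | F∈es , x∈F , y∈F | F′∈es , x∈F′ , y∈F′ with ∈edgeList⁻ F∈es | ∈edgeList⁻ F′∈es
      ... | v , refl | v′ , refl with v ≟ᵥ v′
      ... | yes refl = refl
      ... | no  v≢v′ = contradiction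
              (trans (sym (proj₂ (linear v≢v′ x∈F x∈F′))) (proj₂ (linear v≢v′ y∈F y∈F′))) x≢y

-- Maps of dual hypergraphs and the graph maps they induce.

vertex≡ : ∀ {k} {G : KGraph k} {x y : Vertex G} → proj₁ x ≡ proj₁ y → x ≡ y
vertex≡ {x = x , p} {.x , q} refl = cong (x ,_) ([]=-irrelevant p q)

-- Hyperedges are indexed by graph vertices, so `φ` induces a map `σ` of these. Injectivity of `φ`
-- suffices, so one argument serves automorphisms and both directions of an isomorphism.
module EdgeMap {κ} (Γ Δ : RegularGraph (2 + κ))
  (φ : Vertex (Dual.G Γ) → Vertex (Dual.G Δ)) (φ-injective : Injective _≡_ _≡_ φ)
  (image : ∀ {F} → F List.∈ edges (Dual.G Γ) → ImageIsEdge (Dual.G Γ) (Dual.G Δ) φ F) where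

  private
    module Γ = Dual Γ
    module Δ = Dual Δ

  abstract
    σ : Γ.V → Δ.V
    σ u = proj₁ (Δ.∈edgeList⁻ (proj₁ (proj₂ (image (Γ.∈edgeList⁺ u)))))

    σ-image : ∀ u → IsImage Γ.G Δ.G φ (Γ.E u) (Δ.E (σ u))
    σ-image u = let (F , F∈ , im) = image (Γ.∈edgeList⁺ u) in
      subst (IsImage Γ.G Δ.G φ (Γ.E u)) (proj₂ (Δ.∈edgeList⁻ F∈)) im

  φ∈⁺ : ∀ {u} x → proj₁ x ∈ Γ.E u → proj₁ (φ x) ∈ Δ.E (σ u)
  φ∈⁺ {u} x x∈ = Equivalence.from (σ-image u _) (x , x∈ , refl)

  φ-onto : ∀ {u w} → w ∈ Δ.E (σ u) → ∃ λ x → proj₁ x ∈ Γ.E u × proj₁ (φ x) ≡ w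
  φ-onto {u} w∈ = Equivalence.to (σ-image u _) w∈

  φ∈⁻ : ∀ {u} x → proj₁ (φ x) ∈ Δ.E (σ u) → proj₁ x ∈ Γ.E u
  φ∈⁻ {u} x φx∈ =
    let (y , y∈ , eq) = φ-onto φx∈
    in subst (λ z → proj₁ z ∈ Γ.E u) (φ-injective (vertex≡ {G = Δ.G} eq)) y∈

  σ-injective : Injective _≡_ _≡_ σ
  σ-injective {u} {v} eq = Γ.E-⊆-injective λ {x} x∈ →
    φ∈⁻ (x , Γ.E⊆vertices u x∈) (subst (λ w → _ ∈ Δ.E w) eq (φ∈⁺ _ x∈))

  -- The item joining `σ u` and `σ v` comes from an item of both `E u` and `E v`, so distinct `u`
  -- and `v` are adjacent. For `u ≡ v` that preimage is some `item u w`; its image lies in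
  -- `E (σ w)`, which forces `σ w ≡ σ u` and hence `w ≡ u`.
  σ-reflects : ∀ {u v} → Δ.Adj (σ u) (σ v) → Γ.Adj u v
  σ-reflects {u} {v} a with φ-onto (Δ.item∈E a)
  ... | x , x∈u , eq with u Γ.≟ᵥ v
  ... | no u≢v = proj₁ (Γ.linear u≢v x∈u (φ∈⁻ x (subst (_∈ Δ.E (σ v)) (sym eq) (Δ.item∈Eʳ a))))
  ... | yes refl with Γ.∈E⁻ x∈u
  ... | w , u~w , refl = subst (Γ.Adj u) (σ-injective σw≡σu) u~w
    where
    σw≡σu : σ w ≡ σ u
    σw≡σu = [ id , id ]′ (Δ.item∈E⁻ (subst (_∈ Δ.E (σ w)) eq (φ∈⁺ x (Γ.item∈Eʳ u~w))))

  N≤N : Γ.N ≤ Δ.N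
  N≤N = Fin.injective⇒≤ {f = Δ.code ∘ σ ∘ Inverse.to Γ.enum} λ {i} {j} eq →
    trans (sym (Inverse.strictlyInverseʳ Γ.enum i))
      (trans (cong Γ.code (σ-injective (Δ.code-injective eq))) (Inverse.strictlyInverseʳ Γ.enum j))

-- `N` counts the hyperedges, and an isomorphism and its inverse each inject one index set into the
-- other.
isomorphic⇒N≡N : ∀ {κ} (Γ Δ : RegularGraph (2 + κ)) → Isomorphic (Dual.G Γ) (Dual.G Δ) →
                 RegularGraph.N Γ ≡ RegularGraph.N Δ
isomorphic⇒N≡N Γ Δ (φ , iso) =
  ℕ.≤-antisym (EdgeMap.N≤N Γ Δ to (Bijection.injective φ)
      (λ F∈ → Equivalence.to (iso _ (edge⊆ Γ.G F∈)) F∈))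
              (EdgeMap.N≤N Δ Γ from from-injective preimage)
  where
  module Γ = Dual Γ
  module Δ = Dual Δ
  to   = Bijection.to φ
  from : Vertex Δ.G → Vertex Γ.G
  from y = proj₁ (Bijection.strictlySurjective φ y)
  to∘from : ∀ y → to (from y) ≡ y
  to∘from y = proj₂ (Bijection.strictlySurjective φ y)
  from∘to : ∀ x → from (to x) ≡ x
  from∘to x = Bijection.injective φ (to∘from (to x))
  from-injective : Injective _≡_ _≡_ from
  from-injective {x} {y} eq = trans (sym (to∘from x)) (trans (cong to eq) (to∘from y))

  -- `iso` decides every set of vertices, not only edges: the preimage `P` of `F` is an edge because
  -- its image is the edge `F`.
  preimage : ∀ {F} → F List.∈ edges Δ.G → ImageIsEdge Δ.G Γ.G from F
  preimage {F} F∈ = P , Equivalence.from (iso P P⊆) (F , F∈ , F-image) , P-image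
    where
    In : Fin (size Γ.G) → Set
    In x = ∃ λ p → proj₁ (to (x , p)) ∈ F
    In? : Decidable In
    In? x with x ∈? vertices Γ.G
    ... | no  x∉ = no (x∉ ∘ proj₁)
    ... | yes p  = map′ (p ,_) (λ (q , t) → subst (λ r → proj₁ (to (x , r)) ∈ F) ([]=-irrelevant q p) t)
                        (proj₁ (to (x , p)) ∈? F)
    P : Subset (size Γ.G)
    P = comprehension In?
    P⊆ : P ⊆ vertices Γ.G
    P⊆ = proj₁ ∘ ∈-comprehension⁻ In?
    F-image : IsImage Γ.G Δ.G to P F
    F-image w = mk⇔
      (λ w∈F → let y = (w , edge⊆ Δ.G F∈ w∈F) in
        from y , ∈-comprehension⁺ In? (proj₂ (from y) , subst (λ z → proj₁ z ∈ F) (sym (to∘from y)) w∈F)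
               , cong proj₁ (to∘from y))
      (λ (x , x∈P , eq) → let (p , t) = ∈-comprehension⁻ In? x∈P in
        subst (_∈ F) (trans (cong (proj₁ ∘ to) (vertex≡ {G = Γ.G} refl)) eq) t)
    P-image : IsImage Δ.G Γ.G from F P
    P-image w = mk⇔
      (λ w∈P → let (p , t) = ∈-comprehension⁻ In? w∈P in to (w , p) , t , cong proj₁ (from∘to (w , p)))
      (λ (y , y∈F , eq) → subst (_∈ P) eq
        (∈-comprehension⁺ In? (proj₂ (from y) , subst (λ z → proj₁ z ∈ F) (sym (to∘from y)) y∈F)))

-- Symmetries of the dual and their counterparts on the graph.

module DualSymmetry {κ} (Γ : RegularGraph (2 + κ)) where
  open Dual Γ

  Rigid : Set
  Rigid = ∀ (σ : V → V) → Injective _≡_ _≡_ σ → (∀ {u v} → Adj u v → Adj (σ u) (σ v)) →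
          (∀ {u v} → Adj (σ u) (σ v) → Adj u v) → ∀ u → σ u ≡ u

  -- Once `σ` is the identity, `φ` keeps every hyperedge. The item of a proper edge is the sole
  -- common item of two hyperedges, and the item of a loop at `u` is the sole item of `E u` in no
  -- other hyperedge, so `φ` fixes both kinds.
  rigid⇒asymmetric : Rigid → Asymmetric G
  rigid⇒asymmetric rigid (φ , auto , nontrivial) = nontrivial λ x → vertex≡ {G = G} (φ≡id x)
    where
    open EdgeMap Γ Γ (Bijection.to φ) (Bijection.injective φ) (auto _)

    σ-preserves : ∀ {u v} → Adj u v → Adj (σ u) (σ v)
    σ-preserves {u} {v} a with u ≟ᵥ v
    ... | no u≢v = let x = (item u v , E⊆vertices u (item∈E a)) in
      proj₁ (linear (u≢v ∘ σ-injective) (φ∈⁺ x (item∈E a)) (φ∈⁺ x (item∈Eʳ a)))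
    -- The image of the loop item at `u` lies in some `E (σ w)` as well; pulling back puts the loop
    -- item in `E w`, so `w ≡ u`.
    ... | yes refl with ∈E⁻ (φ∈⁺ (item u u , E⊆vertices u (item∈E a)) (item∈E a))
    ... | z , σu~z , eq with injectiveᵥ⇒surjective σ-injective z
    ... | w , refl = subst (λ y → Adj (σ u) (σ y)) w≡u σu~z
      where
      w≡u : w ≡ u
      w≡u = [ id , id ]′ (item∈E⁻ (φ∈⁻ (item u u , E⊆vertices u (item∈E a))
        (subst (_∈ E (σ w)) eq (item∈Eʳ σu~z))))

    σ≡id : ∀ u → σ u ≡ u
    σ≡id = rigid σ σ-injective σ-preserves σ-reflects

    φ∈E : ∀ {u} x → proj₁ x ∈ E u → proj₁ (Bijection.to φ x) ∈ E u
    φ∈E {u} x x∈ = subst (λ w → _ ∈ E w) (σ≡id u) (φ∈⁺ x x∈)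

    φ≡id : ∀ x → proj₁ (Bijection.to φ x) ≡ proj₁ x
    φ≡id (x , p) with ∈-comprehension⁻ covered? p
    ... | u , x∈u with ∈E⁻ x∈u
    ... | v , a , refl with u ≟ᵥ v
    ... | no u≢v = sym (proj₂ (linear u≢v (φ∈E (_ , p) (item∈E a)) (φ∈E (_ , p) (item∈Eʳ a))))
    ... | yes refl with ∈E⁻ (φ∈E (item u u , p) x∈u)
    ... | z , u~z , eq = trans (sym eq) (cong (item u) z≡u)
      where
      z≡u : z ≡ u
      z≡u = [ id , id ]′ (item∈E⁻ (φ∈⁻ (item u u , p)
        (subst (λ w → _ ∈ E w) (sym (σ≡id z)) (subst (_∈ E z) eq (item∈Eʳ u~z)))))

  -- The item {u , v} lies in no E w with w ∈ S other than E u.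
  Private : (V → Set) → V → V → Set
  Private S u v = v ≡ u ⊎ ¬ S v

  -- The graph side of having no exchangeable items: all private items of `u` lie in the same
  -- members of `S`, so at most one can remain.
  Tidy : (V → Set) → Set
  Tidy S = ∀ {u v w} → S u → Adj u v → Adj u w → Private S u v → Private S u w → v ≡ w

  -- Adjacency is required only between distinct vertices: seen from `S`, a loop and an edge leaving
  -- `S` both give a private item, so `π` may turn one into the other.
  record Reflection (S : V → Set) : Set where
    field
      π          : V → V
      π-closed   : ∀ {u} → S u → S (π u)
      involutive : ∀ {u} → S u → π (π u) ≡ u
      π-adj      : ∀ {u v} → S u → S v → u ≢ v → Adj u v → Adj (π u) (π v)
      moved      : ∃ λ u → S u × π u ≢ u

  -- Induced sub-hypergraphs and their involutions.

  module Induced (W : Subset M) where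

    S : V → Set
    S u = ∀ x → x ∈ E u → x ∈ W

    S? : Decidable S
    S? u = map′ (λ E⊆W x → E⊆W {x}) (λ E⊆W {x} → E⊆W x) (E u ⊆? W)

    H : KGraph k
    H = induced G W

    -- Only the forward inclusion `fE` is asked for; applied at `π u` it gives the reverse one,
    -- because `f` and `π` are involutions.
    involution⇒symmetric : (f : Fin M → Fin M) → (∀ {x} → x ∈ W → f x ∈ W) →
      (∀ {x} → x ∈ W → f (f x) ≡ x) →
      (π : V → V) → (∀ {u} → S u → S (π u)) → (∀ {u} → S u → π (π u) ≡ u) →
      (∀ {u x} → S u → x ∈ E u → f x ∈ E (π u)) →
      (∃ λ x → x ∈ W × f x ≢ x) → Symmetric H
    involution⇒symmetric f f∈ ff π πS ππ fE (x₀ , x₀∈ , fx₀≢) =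
      mk⤖ (inj , surj) , auto , λ trivial → fx₀≢ (cong proj₁ (trivial (x₀ , x₀∈)))
      where
      φ : Vertex H → Vertex H
      φ (x , p) = f x , f∈ p
      φφ : ∀ x → φ (φ x) ≡ x
      φφ (x , p) = vertex≡ {G = H} (ff p)
      inj : Injective _≡_ _≡_ φ
      inj {x} {y} eq = trans (sym (φφ x)) (trans (cong φ eq) (φφ y))
      surj : ∀ y → ∃ λ x → ∀ {z} → z ≡ x → φ z ≡ y
      surj y = φ y , λ { refl → φφ y }
      auto : ∀ F → F List.∈ edges H → ImageIsEdge H H φ F
      auto F F∈ with ∈-filter⁻ (_⊆? W) {xs = edges G} F∈
      ... | F∈G , F⊆W with ∈edgeList⁻ F∈G
      ... | u , refl = E (π u) , ∈-filter⁺ (_⊆? W) (∈edgeList⁺ (π u)) (λ {x} → πS Su x) , λ w → mk⇔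
        (λ w∈ → let p = πS Su w w∈ in (f w , f∈ p) , subst (λ v → f w ∈ E v) (ππ Su)
          (fE (πS Su) w∈) , ff p)
        (λ { (x , x∈ , refl) → fE Su x∈ })
        where
        Su : S u
        Su x x∈ = F⊆W x∈

    Twins : Fin M → Fin M → Set
    Twins x y = ∀ u → S u → (x ∈ E u → y ∈ E u) × (y ∈ E u → x ∈ E u)

    -- The transposition of `x` and `y` maps every hyperedge of `H` to itself.
    twins⇒symmetric : ∀ {x y} → x ∈ W → y ∈ W → x ≢ y → Twins x y → Symmetric H
    twins⇒symmetric {x} {y} x∈ y∈ x≢y twins =
      involution⇒symmetric f f∈ (λ {z} _ → ff z) id id (λ _ → refl) fE
        (x , x∈ , λ eq → x≢y (trans (sym eq) fx))
      where
      f : Fin M → Fin M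
      f z with z Fin.≟ x
      ... | yes _ = y
      ... | no _ with z Fin.≟ y
      ... | yes _ = x
      ... | no  _ = z
      fx : f x ≡ y
      fx with x Fin.≟ x
      ... | yes _   = refl
      ... | no  x≢x = contradiction refl x≢x
      fy : f y ≡ x
      fy with y Fin.≟ x
      ... | yes y≡x = y≡x
      ... | no _ with y Fin.≟ y
      ... | yes _   = refl
      ... | no  y≢y = contradiction refl y≢y
      f≡ : ∀ {z} → z ≢ x → z ≢ y → f z ≡ z
      f≡ {z} z≢x z≢y with z Fin.≟ x
      ... | yes z≡x = contradiction z≡x z≢x
      ... | no _ with z Fin.≟ y
      ... | yes z≡y = contradiction z≡y z≢y
      ... | no  _   = refl
      data Position (z : Fin M) : Set where
        is-x : z ≡ x → Position z
        is-y : z ≡ y → Position z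
        is-neither : z ≢ x → z ≢ y → Position z
      position : ∀ z → Position z
      position z with z Fin.≟ x | z Fin.≟ y
      ... | yes p | _     = is-x p
      ... | no  _ | yes q = is-y q
      ... | no  p | no  q = is-neither p q
      ff : ∀ z → f (f z) ≡ z
      ff z with position z
      ... | is-x refl = trans (cong f fx) fy
      ... | is-y refl = trans (cong f fy) fx
      ... | is-neither p q = trans (cong f (f≡ p q)) (f≡ p q)
      f∈ : ∀ {z} → z ∈ W → f z ∈ W
      f∈ {z} z∈ with position z
      ... | is-x refl = subst (_∈ W) (sym fx) y∈
      ... | is-y refl = subst (_∈ W) (sym fy) x∈
      ... | is-neither p q = subst (_∈ W) (sym (f≡ p q)) z∈
      fE : ∀ {u z} → S u → z ∈ E u → f z ∈ E u
      fE {u} {z} Su z∈ with position z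
      ... | is-x refl = subst (_∈ E u) (sym fx) (proj₁ (twins u Su) z∈)
      ... | is-y refl = subst (_∈ E u) (sym fy) (proj₂ (twins u Su) z∈)
      ... | is-neither p q = subst (_∈ E u) (sym (f≡ p q)) z∈

    Separated : Set
    Separated = ∀ {x y} → x ∈ W → y ∈ W → Twins x y → x ≡ y

    symmetric⊎separated : Symmetric H ⊎ Separated
    symmetric⊎separated with any? (λ x → any? λ y →
        x ∈? W ×-dec y ∈? W ×-dec ¬? (x Fin.≟ y) ×-dec
        allᵥ? (λ u → S? u →-dec ((x ∈? E u →-dec y ∈? E u) ×-dec (y ∈? E u →-dec x ∈? E u))))
    ... | yes (x , y , x∈ , y∈ , x≢y , twins) = inj₁ (twins⇒symmetric x∈ y∈ x≢y twins)
    ... | no ¬twins = inj₂ λ {x} {y} x∈ y∈ twins →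
            decidable-stable (x Fin.≟ y) λ x≢y → ¬twins (x , y , x∈ , y∈ , x≢y , twins)

    private⇒only : ∀ {u v w} → Adj u v → Private S u v → S w → item u v ∈ E w → w ≡ u
    private⇒only a p Sw x∈ with item∈E⁻ x∈ | p
    ... | inj₁ w≡u  | _         = w≡u
    ... | inj₂ w≡v  | inj₁ v≡u  = trans w≡v v≡u
    ... | inj₂ refl | inj₂ ¬Sv  = contradiction Sw ¬Sv

    module _ (separated : Separated) where

      -- Private items of `u` lie in `E u` and in no other member of `S`, so any two of them are
      -- twins.
      separated⇒tidy : Tidy S
      separated⇒tidy {u} Su u~v u~w pv pw = item-injectiveʳ
        (separated (Su _ (item∈E u~v)) (Su _ (item∈E u~w)) λ t St →
           (λ x∈ → subst (λ z → _ ∈ E z) (sym (private⇒only u~v pv St x∈)) (item∈E u~w))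
         , (λ x∈ → subst (λ z → _ ∈ E z) (sym (private⇒only u~w pw St x∈)) (item∈E u~v)))

      module _ (R : Reflection S) where
        open Reflection R

        π-injective : ∀ {u v} → S u → S v → π u ≡ π v → u ≡ v
        π-injective Su Sv eq = trans (sym (involutive Su)) (trans (cong π eq) (involutive Sv))

        -- If every neighbour of π u were a non-private one, π would map all k neighbours of π u
        -- onto those of u, private ones included.
        private-transfer : ∀ {u v} → S u → Adj u v → Private S u v →
          ∃ λ w → Adj (π u) w × Private S (π u) w
        private-transfer {u} {v} Su u~v pv
          with any? (λ s → (nb (π u) s ≟ᵥ π u) ⊎-dec ¬? (S? (nb (π u) s)))
        ... | yes (s , p) = nb (π u) s , nb-adj (π u) s , p
        ... | no ¬p = contradiction pv ¬pv
          where
          Snb : ∀ s → S (nb (π u) s)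
          Snb s = decidable-stable (S? _) λ ¬S → ¬p (s , inj₂ ¬S)
          back : ∀ s → Adj u (π (nb (π u) s))
          back s = subst (λ z → Adj z (π (nb (π u) s))) (involutive Su)
            (π-adj (π-closed Su) (Snb s) (λ eq → ¬p (s , inj₁ (sym eq))) (nb-adj (π u) s))
          g : Fin k → Fin k
          g s = proj₁ (adj-nb (back s))
          g-eq : ∀ s → nb u (g s) ≡ π (nb (π u) s)
          g-eq s = proj₂ (adj-nb (back s))
          g-injective : Injective _≡_ _≡_ g
          g-injective {s} {t} eq = nb-injective (π u) (π-injective (Snb s) (Snb t)
            (trans (sym (g-eq s)) (trans (cong (nb u) eq) (g-eq t))))
          ¬pv : ¬ Private S u v
          ¬pv pv = [ (λ v≡u → ¬p (t , inj₁ (trans (sym (involutive (Snb t)))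
                      (cong π (trans (sym v≡) v≡u)))))
                   , (λ ¬Sv → ¬Sv (subst S (sym v≡) (π-closed (Snb t)))) ]′ pv
            where
            s = proj₁ (adj-nb u~v)
            t = proj₁ (injective⇒surjective g-injective s)
            v≡ : v ≡ π (nb (π u) t)
            v≡ = trans (sym (proj₂ (adj-nb u~v)))
                   (trans (cong (nb u) (sym (proj₂ (injective⇒surjective g-injective s)))) (g-eq t))

        Corresponds : Fin M → Fin M → Set
        Corresponds x y = y ∈ W × (∀ {u} → S u → (x ∈ E u → y ∈ E (π u)) × (y ∈ E (π u) → x ∈ E u))

        corresponds-private : ∀ {u v} → S u → Adj u v → Private S u v → ∃ (Corresponds (item u v))
        corresponds-private {u} {v} Su u~v pv with private-transfer Su u~v pv
        ... | w , πu~w , pw = item (π u) w , π-closed Su _ (item∈E πu~w) , λ {t} St →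
             (λ x∈ → subst (λ z → _ ∈ E (π z)) (sym (private⇒only u~v pv St x∈)) (item∈E πu~w))
           , (λ y∈ → subst (λ z → _ ∈ E z) (sym (π-injective St Su (private⇒only πu~w pw (π-closed St) y∈)))
               (item∈E u~v))

        corresponds-shared : ∀ {u v} → S u → S v → u ≢ v → Adj u v → ∃ (Corresponds (item u v))
        corresponds-shared {u} {v} Su Sv u≢v u~v = item (π u) (π v) , π-closed Su _ (item∈E πu~πv) ,
          λ {t} St →
             (λ x∈ → [ (λ { refl → item∈E πu~πv }) , (λ { refl → item∈Eʳ πu~πv }) ]′ (item∈E⁻ x∈))
           , (λ y∈ → [ (λ eq → subst (λ z → _ ∈ E z) (sym (π-injective St Su eq)) (item∈E u~v))
                     , (λ eq → subst (λ z → _ ∈ E z) (sym (π-injective St Sv eq)) (item∈Eʳ u~v)) ]′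
                       (item∈E⁻ y∈))
          where πu~πv = π-adj Su Sv u≢v u~v

        corresponds : ∀ {x} → x ∈ W → ∃ (Corresponds x)
        corresponds {x} x∈W with anyᵥ? (λ u → S? u ×-dec x ∈? E u)
        -- As `π` maps `S` into itself, an item outside all members of `S` may stay in place.
        ... | no ¬seen = x , x∈W , λ {u} Su →
              (λ x∈ → contradiction (u , Su , x∈) ¬seen)
            , (λ x∈ → contradiction (π u , π-closed Su , x∈) ¬seen)
        ... | yes (u , Su , x∈) with ∈E⁻ x∈
        ... | v , u~v , refl with u ≟ᵥ v | S? v
        ... | yes refl | _      = corresponds-private Su u~v (inj₁ refl)
        ... | no  _    | no ¬Sv = corresponds-private Su u~v (inj₂ ¬Sv)
        ... | no u≢v   | yes Sv = corresponds-shared Su Sv u≢v u~v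

        f : Fin M → Fin M
        f x with x ∈? W
        ... | yes x∈ = proj₁ (corresponds x∈)
        ... | no  _  = x

        f-corresponds : ∀ {x} → x ∈ W → Corresponds x (f x)
        f-corresponds {x} x∈ with x ∈? W
        ... | yes x∈′ = proj₂ (corresponds x∈′)
        ... | no  x∉  = contradiction x∈ x∉

        f∈ : ∀ {x} → x ∈ W → f x ∈ W
        f∈ = proj₁ ∘ f-corresponds

        fE : ∀ {u x} → S u → x ∈ E u → f x ∈ E (π u)
        fE Su x∈ = proj₁ (proj₂ (f-corresponds (Su _ x∈)) Su) x∈

        fE⁻ : ∀ {u x} → S u → x ∈ W → f x ∈ E (π u) → x ∈ E u
        fE⁻ Su x∈W = proj₂ (proj₂ (f-corresponds x∈W) Su)

        -- `f` is built from arbitrary choices, yet `f (f x)` lies in exactly the members of `S`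
        -- that contain `x`, and separation then identifies the two.
        ff : ∀ {x} → x ∈ W → f (f x) ≡ x
        ff {x} x∈W = separated (f∈ (f∈ x∈W)) x∈W λ u Su →
            (λ ffx∈ → fE⁻ Su x∈W (fE⁻ (π-closed Su) (f∈ x∈W)
              (subst (λ z → _ ∈ E z) (sym (involutive Su)) ffx∈)))
          , (λ x∈ → subst (λ z → _ ∈ E z) (involutive Su) (fE (π-closed Su) (fE Su x∈)))

        reflection⇒symmetric : Symmetric H
        reflection⇒symmetric with moved
        ... | u , Su , πu≢u with any? (λ s → ¬? (f (item u (nb u s)) Fin.≟ item u (nb u s)))
        ... | yes (s , fx≢x) = involution⇒symmetric f f∈ ff π π-closed involutive fE
                                 (_ , Su _ (item∈E (nb-adj u s)) , fx≢x)
        -- If `f` fixed all items of `E u`, then `E u ⊆ E (π u)`, hence `π u ≡ u`.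
        ... | no ¬moved = contradiction (sym (E-⊆-injective Eu⊆)) πu≢u
          where
          Eu⊆ : E u ⊆ E (π u)
          Eu⊆ {x} x∈ with ∈E⇒nb x∈
          ... | s , refl = subst (_∈ E (π u))
            (decidable-stable (_ Fin.≟ _) (λ ne → ¬moved (s , ne))) (fE Su x∈)

  -- If every hyperedge survives, `W` contains all vertices of `G`; if none does, any two elements
  -- of `W` are twins and `W` has at most one. Both contradict the bounds on `∣ W ∣`, and otherwise
  -- the reflection lifts.
  minimalAsymmetric : Rigid →
    (∀ {S} → Decidable S → Tidy S → (∀ u → S u) ⊎ (∀ u → ¬ S u) ⊎ Reflection S) →
    MinimalAsymmetric G
  minimalAsymmetric rigid tidy-cases = rigid⇒asymmetric rigid , sym-induced
    where
    sym-induced : ∀ W → W ⊆ vertices G → 2 ≤ ∣ W ∣ → ∣ W ∣ < ∣ vertices G ∣ → Symmetric (induced G W)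
    sym-induced W _ 2≤W W<G with Induced.symmetric⊎separated W
    ... | inj₁ symmetric = symmetric
    ... | inj₂ separated with tidy-cases (Induced.S? W) (Induced.separated⇒tidy W separated)
    ... | inj₁ all = contradiction
            (p⊆q⇒∣p∣≤∣q∣ λ x∈ → let (u , x∈u) = ∈-comprehension⁻ covered? x∈ in all u _ x∈u) (ℕ.<⇒≱ W<G)
    ... | inj₂ (inj₁ none) = contradiction
            (∣p∣≤1 W λ x∈ y∈ → separated x∈ y∈ λ u Su → contradiction Su (none u)) (ℕ.<⇒≱ 2≤W)
    ... | inj₂ (inj₂ R) = Induced.reflection⇒symmetric W separated R

-- Cyclic order, monotone maps and the slots of a half graph.

prev : ∀ {m} → Fin (suc m) → Fin (suc m)
prev {m} zero = fromℕ m
prev (suc t)  = inject₁ t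

next : ∀ {m} → Fin (suc m) → Fin (suc m)
next t with view t
... | ‵fromℕ     = zero
... | ‵inject₁ s = suc s

prev-next : ∀ {m} (t : Fin (suc m)) → prev (next t) ≡ t
prev-next t with view t
... | ‵fromℕ     = refl
... | ‵inject₁ _ = refl

next-prev : ∀ {m} (t : Fin (suc m)) → next (prev t) ≡ t
next-prev {m} zero rewrite view-fromℕ m = refl
next-prev (suc t) rewrite view-inject₁ t = refl

prev-injective : ∀ {m} {s t : Fin (suc m)} → prev s ≡ prev t → s ≡ t
prev-injective {s = s} {t} eq = trans (sym (next-prev s)) (trans (cong next eq) (next-prev t))

-- From `s` the steps climb to the last element, wrap around to zero and climb again through the
-- whole range.
cyclic-induction : ∀ {m} (P : Fin (suc m) → Set) → (∀ t → P (prev t) → P t) →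
                   ∀ {s} → P s → ∀ t → P t
cyclic-induction {m} P step {s} Ps =
  <-weakInduction P (step zero (<-weakInduction-startingFrom P Ps (step ∘ suc) (Fin.≤fromℕ s)))
    (step ∘ suc)

prev≢ : ∀ {m} (t : Fin (2 + m)) → prev t ≢ t
prev≢ (suc t) eq = ℕ.1+n≢n (trans (sym (cong toℕ eq)) (Fin.toℕ-inject₁ t))

-- The cycle has length at least three. This keeps the neighbours below a layer apart from those
-- above it.
prev²≢ : ∀ {m} (t : Fin (3 + m)) → prev (prev t) ≢ t
prev²≢ (suc (suc t)) eq = ℕ.<⇒≢ (ℕ.m<n⇒m<1+n (ℕ.n<1+n (toℕ t)))
  (trans (sym (trans (Fin.toℕ-inject₁ (inject₁ t)) (Fin.toℕ-inject₁ t))) (cong toℕ eq))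

opposite-fromℕ : ∀ n → opposite (fromℕ n) ≡ zero
opposite-fromℕ n = Fin.opposite-involutive {suc n} zero

opposite-inject₁ : ∀ {n} (i : Fin n) → opposite (inject₁ i) ≡ suc (opposite i)
opposite-inject₁ i = trans (cong (opposite ∘ inject₁) (sym (Fin.opposite-involutive i)))
                           (Fin.opposite-involutive (suc (opposite i)))

-- A strictly increasing map gains at least 1 per step: upward from zero this gives `i ≤ f i`,
-- downward from the top `f i ≤ i`.
strictlyMonotone⇒id : ∀ {n} (f : Fin n → Fin n) → (∀ {i j} → i Fin.< j → f i Fin.< f j) → ∀ i → f i ≡ i
strictlyMonotone⇒id {suc n} f mono i = Fin.≤-antisym (below i) (above i)
  where
  step : ∀ i → f (inject₁ i) Fin.< f (suc i)
  step i = mono {inject₁ i} {suc i} (s≤s (ℕ.≤-reflexive (Fin.toℕ-inject₁ i)))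
  above : ∀ i → i Fin.≤ f i
  above = <-weakInduction (λ i → i Fin.≤ f i) z≤n λ i i≤ →
    ℕ.≤-<-trans (subst (_≤ toℕ (f (inject₁ i))) (Fin.toℕ-inject₁ i) i≤) (step i)
  below : ∀ i → f i Fin.≤ i
  below = >-weakInduction (λ i → f i Fin.≤ i) (Fin.≤fromℕ _) λ i ≤i →
    subst (toℕ (f (inject₁ i)) ≤_) (sym (Fin.toℕ-inject₁ i)) (s≤s⁻¹ (ℕ.<-≤-trans (step i) ≤i))

-- Among the n + 1 base neighbours of (t , i), the slots s ≤ i lead down to (prev t , s)
-- and the slots s > i lead up to (next t , s − 1).
slot : ∀ {n} → Fin n → Fin (suc n) → Fin n ⊎ Fin n
slot {suc n} i       zero    = inj₁ zero
slot {suc n} zero    (suc j) = inj₂ j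
slot {suc n} (suc i) (suc s) = map⊎ suc suc (slot i s)

unslot : ∀ {n} → Fin n ⊎ Fin n → Fin (suc n)
unslot (inj₁ j) = inject₁ j
unslot (inj₂ j) = suc j

-- A left inverse makes `slot i` injective, so distinct slots lead to distinct neighbours.
unslot-slot : ∀ {n} (i : Fin n) s → unslot (slot i s) ≡ s
unslot-slot {suc n} i       zero    = refl
unslot-slot {suc n} zero    (suc j) = refl
unslot-slot {suc n} (suc i) (suc s) with slot i s | unslot-slot i s
... | inj₁ _ | eq = cong suc eq
... | inj₂ _ | eq = cong suc eq

slot-down : ∀ {n} (i : Fin n) s {j} → slot i s ≡ inj₁ j → j Fin.≤ i
slot-down {suc n} i       zero    refl = z≤n
slot-down {suc n} (suc i) (suc s) eq with slot i s in eq′ | eq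
... | inj₁ _ | refl = s≤s (slot-down i s eq′)

slot-up : ∀ {n} (i : Fin n) s {j} → slot i s ≡ inj₂ j → i Fin.≤ j
slot-up {suc n} zero    (suc s) refl = z≤n
slot-up {suc n} (suc i) (suc s) eq with slot i s in eq′ | eq
... | inj₂ _ | refl = s≤s (slot-up i s eq′)

slot-inject₁ : ∀ {n} {i j : Fin n} → j Fin.≤ i → slot i (inject₁ j) ≡ inj₁ j
slot-inject₁ {suc n} {i}     {zero}  _         = refl
slot-inject₁ {suc n} {suc i} {suc j} (s≤s j≤i) = cong (map⊎ suc suc) (slot-inject₁ j≤i)

slot-suc : ∀ {n} {i j : Fin n} → i Fin.≤ j → slot i (suc j) ≡ inj₂ j
slot-suc {suc n} {zero}  {j}     _         = refl
slot-suc {suc n} {suc i} {suc j} (s≤s i≤j) = cong (map⊎ suc suc) (slot-suc i≤j)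

-- The layered graph.

module Layered (r n′ : ℕ) where

  n m : ℕ
  n = suc n′
  m = 7 + r

  V : Set
  V = Fin m × Fin n

  chord : Fin m → Fin m
  chord 0F = 2F
  chord 1F = 4F
  chord 2F = 0F
  chord 3F = 3F
  chord 4F = 1F
  chord (suc (suc (suc (suc (suc t))))) = suc (suc (suc (suc (suc t))))

  chord-involutive : ∀ t → chord (chord t) ≡ t
  chord-involutive 0F = refl
  chord-involutive 1F = refl
  chord-involutive 2F = refl
  chord-involutive 3F = refl
  chord-involutive 4F = refl
  chord-involutive (suc (suc (suc (suc (suc t))))) = refl

  -- Chords never join consecutive layers, so the mate of a vertex does not repeat one of its layer
  -- neighbours.
  chord≢prev : ∀ t → chord t ≢ prev t
  chord≢prev 0F ()
  chord≢prev 1F ()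
  chord≢prev 2F ()
  chord≢prev 3F ()
  chord≢prev 4F ()
  chord≢prev t@(suc (suc (suc (suc (suc _))))) eq = prev≢ t (sym eq)

  -- The involution whose fixed points carry a loop.
  mate : V → V
  mate (t , zero)  = chord t , zero
  mate (t , suc i) = t , suc i

  mate-involutive : ∀ u → mate (mate u) ≡ u
  mate-involutive (t , zero)  = cong (_, zero) (chord-involutive t)
  mate-involutive (t , suc i) = refl

  mate≢prev : ∀ {t i j} → mate (t , i) ≢ (prev t , j)
  mate≢prev {t} {zero}  eq = chord≢prev t (cong proj₁ eq)
  mate≢prev {t} {suc i} eq = prev≢ t (sym (cong proj₁ eq))

  mate≢next : ∀ {t i j} → mate (prev t , i) ≢ (t , j)
  mate≢next {t} {i} {j} eq = mate≢prev (trans (cong mate (sym eq)) (mate-involutive (prev t , i)))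

  data Adj : V → V → Set where
    up    : ∀ {s t i j} → s ≡ prev t → i Fin.≤ j → Adj (s , i) (t , j)
    down  : ∀ {s t i j} → t ≡ prev s → j Fin.≤ i → Adj (s , i) (t , j)
    mates : ∀ {u v} → v ≡ mate u → Adj u v

  adj-sym : ∀ {u v} → Adj u v → Adj v u
  adj-sym (up p q)     = down p q
  adj-sym (down p q)   = up p q
  adj-sym (mates {u} refl) = mates (sym (mate-involutive u))

  step : Fin m → Fin n ⊎ Fin n → V
  step t (inj₁ j) = prev t , j
  step t (inj₂ j) = next t , j

  -- Beside the mate there are `i + 1` neighbours below and `n - i` above, so the degree is `n + 2`
  -- in every row.
  nb : V → Fin (2 + n) → V
  nb u       zero    = mate u
  nb (t , i) (suc s) = step t (slot i s)

  step-injective : ∀ t {x y} → step t x ≡ step t y → x ≡ y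
  step-injective t {inj₁ _} {inj₁ _} refl = refl
  step-injective t {inj₂ _} {inj₂ _} refl = refl
  step-injective t {inj₁ _} {inj₂ _} eq =
    contradiction (trans (cong (prev ∘ proj₁) eq) (prev-next t)) (prev²≢ t)
  step-injective t {inj₂ _} {inj₁ _} eq =
    contradiction (trans (cong (prev ∘ proj₁) (sym eq)) (prev-next t)) (prev²≢ t)

  mate≢step : ∀ {t i} x → mate (t , i) ≢ step t x
  mate≢step (inj₁ j) eq = mate≢prev eq
  mate≢step {t} {i} (inj₂ j) eq = mate≢next (trans (cong (λ s → mate (s , i)) (prev-next t)) eq)

  nb-injective : ∀ u → Injective _≡_ _≡_ (nb u)
  nb-injective u       {zero}  {zero}   _  = refl
  nb-injective (t , i) {zero}  {suc s}  eq = contradiction eq (mate≢step (slot i s))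
  nb-injective (t , i) {suc s} {zero}   eq = contradiction (sym eq) (mate≢step (slot i s))
  nb-injective (t , i) {suc s} {suc s′} eq =
    cong suc (trans (sym (unslot-slot i s)) (trans (cong unslot (step-injective t eq))
      (unslot-slot i s′)))

  nb-adj : ∀ u s → Adj u (nb u s)
  nb-adj u       zero    = mates refl
  nb-adj (t , i) (suc s) with slot i s in eq
  ... | inj₁ j = down refl (slot-down i s eq)
  ... | inj₂ j = up (sym (prev-next t)) (slot-up i s eq)

  adj-nb : ∀ {u v} → Adj u v → ∃ λ s → nb u s ≡ v
  adj-nb (mates eq) = zero , sym eq
  adj-nb {t , i} (down {j = j} refl j≤i) = suc (inject₁ j) , cong (step t) (slot-inject₁ j≤i)
  adj-nb {_ , i} (up {t = t} {j = j} refl i≤j) = suc (suc j) ,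
    trans (cong (step (prev t)) (slot-suc i≤j)) (cong (_, j) (next-prev t))

  Γ : RegularGraph (2 + n)
  Γ = record
    { V = V ; N = m * n ; enum = Fin.*↔× ; Adj = Adj ; nb = nb
    ; nb-injective = nb-injective ; nb-adj = nb-adj ; adj-nb = adj-nb ; adj-sym = adj-sym }

  open DualSymmetry Γ using (Rigid; Tidy)

  loop : ∀ {u} → mate u ≡ u → Adj u u
  loop eq = mates (sym eq)

  loop⁻ : ∀ {u} → Adj u u → mate u ≡ u
  loop⁻ {t , _} (up eq _)   = contradiction (sym eq) (prev≢ t)
  loop⁻ {t , _} (down eq _) = contradiction (sym eq) (prev≢ t)
  loop⁻ (mates eq)          = sym eq

  adj-up⁻ : ∀ {t i j} → Adj (prev t , i) (t , j) → i Fin.≤ j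
  adj-up⁻ (up _ i≤j)      = i≤j
  adj-up⁻ {t} (down eq _) = contradiction (sym eq) (prev²≢ t)
  adj-up⁻ (mates eq)      = contradiction (sym eq) mate≢next

  -- Rigidity of the layered graph.

  module _ (σ : V → V) (σ-injective : Injective _≡_ _≡_ σ)
    (σ-preserves : ∀ {u v} → Adj u v → Adj (σ u) (σ v))
    (σ-reflects : ∀ {u v} → Adj (σ u) (σ v) → Adj u v) where

    -- These are the unlooped vertices; index 3 stands for layer 4.
    corner : Fin 4 → V
    corner 0F = 0F , 0F
    corner 1F = 1F , 0F
    corner 2F = 2F , 0F
    corner 3F = 4F , 0F

    uncorner : Fin m → Fin 4
    uncorner 0F = 0F
    uncorner 1F = 1F
    uncorner 2F = 2F
    uncorner (suc (suc (suc _))) = 3F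

    uncorner-corner : ∀ p → uncorner (proj₁ (corner p)) ≡ p
    uncorner-corner 0F = refl
    uncorner-corner 1F = refl
    uncorner-corner 2F = refl
    uncorner-corner 3F = refl

    corner-injective : Injective _≡_ _≡_ corner
    corner-injective {p} {q} eq =
      trans (sym (uncorner-corner p)) (trans (cong (uncorner ∘ proj₁) eq) (uncorner-corner q))

    corner-unlooped : ∀ p → mate (corner p) ≢ corner p
    corner-unlooped 0F ()
    corner-unlooped 1F ()
    corner-unlooped 2F ()
    corner-unlooped 3F ()

    unlooped⇒corner : ∀ u → mate u ≢ u → ∃ λ p → u ≡ corner p
    unlooped⇒corner (0F , zero)  _  = 0F , refl
    unlooped⇒corner (1F , zero)  _  = 1F , refl
    unlooped⇒corner (2F , zero)  _  = 2F , refl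
    unlooped⇒corner (3F , zero)  ne = contradiction refl ne
    unlooped⇒corner (4F , zero)  _  = 3F , refl
    unlooped⇒corner (suc (suc (suc (suc (suc _)))) , zero) ne = contradiction refl ne
    unlooped⇒corner (_  , suc _) ne = contradiction refl ne

    -- The graph on the corners is a paw: the layer edges 01 and 12 and the chord 02 form a
    -- triangle, and the chord 13 is a pendant edge.
    data Link : Fin 4 → Fin 4 → Set where
      01′ : Link 0F 1F
      10′ : Link 1F 0F
      02′ : Link 0F 2F
      20′ : Link 2F 0F
      12′ : Link 1F 2F
      21′ : Link 2F 1F
      13′ : Link 1F 3F
      31′ : Link 3F 1F

    adj⇒link : ∀ p q → p ≢ q → Adj (corner p) (corner q) → Link p q
    adj⇒link 0F 0F ne _ = contradiction refl ne
    adj⇒link 1F 1F ne _ = contradiction refl ne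
    adj⇒link 2F 2F ne _ = contradiction refl ne
    adj⇒link 3F 3F ne _ = contradiction refl ne
    adj⇒link 0F 1F _ _ = 01′
    adj⇒link 1F 0F _ _ = 10′
    adj⇒link 0F 2F _ _ = 02′
    adj⇒link 2F 0F _ _ = 20′
    adj⇒link 1F 2F _ _ = 12′
    adj⇒link 2F 1F _ _ = 21′
    adj⇒link 1F 3F _ _ = 13′
    adj⇒link 3F 1F _ _ = 31′
    adj⇒link 0F 3F _ (up () _)
    adj⇒link 0F 3F _ (down () _)
    adj⇒link 0F 3F _ (mates ())
    adj⇒link 3F 0F _ (up () _)
    adj⇒link 3F 0F _ (down () _)
    adj⇒link 3F 0F _ (mates ())
    adj⇒link 2F 3F _ (up () _)
    adj⇒link 2F 3F _ (down () _)
    adj⇒link 2F 3F _ (mates ())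
    adj⇒link 3F 2F _ (up () _)
    adj⇒link 3F 2F _ (down () _)
    adj⇒link 3F 2F _ (mates ())

    -- 0, 1, 2 span the only triangle, and 1 is its only member with a further neighbour.
    paw : ∀ {d c a b} → Link d b → Link d c → Link c a → Link d a → b ≢ c → b ≢ a →
          (d ≡ 1F × b ≡ 3F) × ((c ≡ 0F × a ≡ 2F) ⊎ (c ≡ 2F × a ≡ 0F))
    paw 01′ 01′ 12′ 02′ b≢c b≢a = contradiction refl b≢c
    paw 02′ 01′ 12′ 02′ b≢c b≢a = contradiction refl b≢a
    paw 01′ 02′ 21′ 01′ b≢c b≢a = contradiction refl b≢a
    paw 02′ 02′ 21′ 01′ b≢c b≢a = contradiction refl b≢c
    paw 10′ 10′ 02′ 12′ b≢c b≢a = contradiction refl b≢c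
    paw 12′ 10′ 02′ 12′ b≢c b≢a = contradiction refl b≢a
    paw 13′ 10′ 02′ 12′ b≢c b≢a = (refl , refl) , inj₁ (refl , refl)
    paw 10′ 12′ 20′ 10′ b≢c b≢a = contradiction refl b≢a
    paw 12′ 12′ 20′ 10′ b≢c b≢a = contradiction refl b≢c
    paw 13′ 12′ 20′ 10′ b≢c b≢a = (refl , refl) , inj₂ (refl , refl)
    paw 20′ 20′ 01′ 21′ b≢c b≢a = contradiction refl b≢c
    paw 21′ 20′ 01′ 21′ b≢c b≢a = contradiction refl b≢a
    paw 20′ 21′ 10′ 20′ b≢c b≢a = contradiction refl b≢a
    paw 21′ 21′ 10′ 20′ b≢c b≢a = contradiction refl b≢c
    paw 31′ 31′ () 31′ _ _

    private
      -- `σ` reflects loops, so unlooped vertices go to unlooped ones.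
      τ∃ : ∀ p → ∃ λ q → σ (corner p) ≡ corner q
      τ∃ p = unlooped⇒corner _ λ eq → corner-unlooped p (loop⁻ (σ-reflects (loop eq)))

    τ : Fin 4 → Fin 4
    τ p = proj₁ (τ∃ p)

    σ-corner : ∀ p → σ (corner p) ≡ corner (τ p)
    σ-corner p = proj₂ (τ∃ p)

    τ-injective : ∀ {p q} → p ≢ q → τ p ≢ τ q
    τ-injective {p} {q} p≢q eq = p≢q (corner-injective (σ-injective
      (trans (σ-corner p) (trans (cong corner eq) (sym (σ-corner q))))))

    τ-link : ∀ p q → p ≢ q → Adj (corner p) (corner q) → Link (τ p) (τ q)
    τ-link p q p≢q a = adj⇒link (τ p) (τ q) (τ-injective p≢q)
      (subst (λ v → Adj (corner (τ p)) v) (σ-corner q)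
        (subst (λ u → Adj u _) (σ-corner p) (σ-preserves a)))

    x : V
    x = 3F , 0F

    looped-preserved : ∀ {u} → mate u ≡ u → mate (σ u) ≡ σ u
    looped-preserved eq = loop⁻ (σ-preserves (loop eq))

    -- The neighbours of `(4 , 0)` are `(3 , 0)`, layer 5 and `(1 , 0)`. Layer 5 is out of reach of
    -- `(2 , 0)`, and `(1 , 0)` is a common neighbour but unlooped.
    common-2-4 : ∀ {w} → mate w ≡ w → Adj (2F , 0F) w → Adj (4F , 0F) w → w ≡ x
    common-2-4 _ (up {t = suc _} eq _) (down {j = zero} refl _) = refl
    common-2-4 _ (up eq _) (up eq′ _) with trans eq (sym eq′)
    ... | ()
    common-2-4 _ (up () _) (mates refl)
    common-2-4 _ (down refl _) (up () _)
    common-2-4 _ (down refl _) (down () _)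
    common-2-4 () (down refl z≤n) (mates refl)
    common-2-4 _ (mates refl) (up () _)
    common-2-4 _ (mates refl) (down () _)
    common-2-4 _ (mates refl) (mates ())

    -- The only common neighbour is `(1 , 0)`, which is unlooped; as `m ≥ 7`, the layer below 0 is
    -- not layer 5. This tells corner 0 from corner 2.
    common-0-4 : ∀ {w} → mate w ≡ w → Adj (0F , 0F) w → ¬ Adj (4F , 0F) w
    common-0-4 _ (up eq _) (up eq′ _) with trans eq (sym eq′)
    ... | ()
    common-0-4 _ (up () _) (down refl _)
    common-0-4 () (up _ _) (mates refl)
    common-0-4 _ (down refl _) (up () _)
    common-0-4 _ (down refl _) (down () _)
    common-0-4 _ (down refl _) (mates ())
    common-0-4 _ (mates refl) (up () _)
    common-0-4 _ (mates refl) (down () _)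
    common-0-4 _ (mates refl) (mates ())

    σx~ : ∀ p → Adj (corner p) x → Adj (corner (τ p)) (σ x)
    σx~ p a = subst (λ u → Adj u (σ x)) (σ-corner p) (σ-preserves a)

    τ-fixed : (τ 0F ≡ 0F × τ 1F ≡ 1F) × (τ 2F ≡ 2F × τ 3F ≡ 3F)
    τ-fixed with paw (τ-link 1F 3F (λ ()) (mates refl)) (τ-link 1F 0F (λ ()) (down refl z≤n))
                     (τ-link 0F 2F (λ ()) (mates refl)) (τ-link 1F 2F (λ ()) (up refl z≤n))
                     (τ-injective {3F} {0F} λ ()) (τ-injective {3F} {2F} λ ())
    ... | (τ1 , τ3) , inj₁ (τ0 , τ2) = (τ0 , τ1) , (τ2 , τ3)
    -- If corners 0 and 2 were exchanged, `σ x` would be a looped common neighbour of `(0 , 0)` and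
    -- `(4 , 0)`.
    ... | (_  , τ3) , inj₂ (_  , τ2) = contradiction
            (subst (λ p → Adj (corner p) (σ x)) τ3 (σx~ 3F (down refl z≤n)))
            (common-0-4 (looped-preserved refl)
              (subst (λ p → Adj (corner p) (σ x)) τ2 (σx~ 2F (up refl z≤n))))

    fixed-corner : ∀ p → τ p ≡ p → σ (corner p) ≡ corner p
    fixed-corner p eq = trans (σ-corner p) (cong corner eq)

    fixed-0 : σ (0F , 0F) ≡ (0F , 0F)
    fixed-0 = fixed-corner 0F (proj₁ (proj₁ τ-fixed))
    fixed-1 : σ (1F , 0F) ≡ (1F , 0F)
    fixed-1 = fixed-corner 1F (proj₂ (proj₁ τ-fixed))
    fixed-2 : σ (2F , 0F) ≡ (2F , 0F)
    fixed-2 = fixed-corner 2F (proj₁ (proj₂ τ-fixed))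
    fixed-4 : σ (4F , 0F) ≡ (4F , 0F)
    fixed-4 = fixed-corner 3F (proj₂ (proj₂ τ-fixed))

    fixed-x : σ x ≡ x
    fixed-x = common-2-4 (looped-preserved refl)
      (subst (λ u → Adj u (σ x)) fixed-2 (σ-preserves (up refl z≤n)))
      (subst (λ u → Adj u (σ x)) fixed-4 (σ-preserves (down refl z≤n)))

    fixed-mate : ∀ t → σ (t , 0F) ≡ (t , 0F) → σ (mate (t , 0F)) ≡ mate (t , 0F)
    fixed-mate 0F _ = fixed-2
    fixed-mate 1F _ = fixed-4
    fixed-mate 2F _ = fixed-0
    fixed-mate 3F p = p
    fixed-mate 4F _ = fixed-1
    fixed-mate (suc (suc (suc (suc (suc _))))) p = p

    Fixed : Fin m → Set
    Fixed t = ∀ j → σ (t , j) ≡ (t , j)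

    -- The neighbours of `(prev t , 0)` are all of layer `t`, the vertex `(prev (prev t) , 0)` and
    -- the mate. The last two are fixed and differ from `(t , j)`, so by injectivity the image of
    -- `(t , j)` is neither.
    stays-in-layer : ∀ t → σ (prev t , 0F) ≡ (prev t , 0F) →
                     σ (prev (prev t) , 0F) ≡ (prev (prev t) , 0F) →
                     ∀ j → ∃ λ j′ → σ (t , j) ≡ (t , j′)
    stays-in-layer t p q j with σ (t , j) in eq |
      subst (λ u → Adj u (σ (t , j))) p (σ-preserves (up refl z≤n))
    ... | _ | up {j = j′} eq′ _ = j′ , cong (_, j′) (sym (prev-injective eq′))
    ... | _ | down {j = zero} refl _ =
      contradiction (sym (cong proj₁ (σ-injective (trans eq (sym q))))) (prev²≢ t)
    ... | _ | mates refl =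
      contradiction (sym (σ-injective (trans eq (sym (fixed-mate (prev t) p))))) (mate≢next {t} {0F} {j})

    -- A vertex `(t , j)` is adjacent to `(prev t , i)` exactly for `i ≤ j`, so its neighbours in
    -- the fixed layer below determine `j`.
    fixed-next : ∀ t → σ (prev (prev t) , 0F) ≡ (prev (prev t) , 0F) → Fixed (prev t) → Fixed t
    fixed-next t p Q j with stays-in-layer t (Q 0F) p j
    ... | j′ , eq = trans eq (cong (t ,_) (Fin.≤-antisym
      (adj-up⁻ (σ-reflects (subst (λ u → Adj u (σ (t , j))) (sym (Q j′))
        (subst (Adj (prev t , j′)) (sym eq) (up refl ℕ.≤-refl)))))
      (adj-up⁻ (subst (Adj (prev t , j)) eq
        (subst (λ u → Adj u (σ (t , j))) (Q j) (σ-preserves (up refl ℕ.≤-refl)))))))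

    -- σ acts on layers 4 and 5 by f and g with i ≤ j ⇔ f i ≤ g j, so j > i gives f j ≰ g i ≥ f i.
    fixed-layer-4 : Fixed 4F
    fixed-layer-4 j = trans (f-eq j) (cong (4F ,_) (strictlyMonotone⇒id f mono j))
      where
      f g : Fin n → Fin n
      f i = proj₁ (stays-in-layer 4F fixed-x fixed-2 i)
      g i = proj₁ (stays-in-layer 5F fixed-4 fixed-x i)
      f-eq : ∀ i → σ (4F , i) ≡ (4F , f i)
      f-eq i = proj₂ (stays-in-layer 4F fixed-x fixed-2 i)
      g-eq : ∀ i → σ (5F , i) ≡ (5F , g i)
      g-eq i = proj₂ (stays-in-layer 5F fixed-4 fixed-x i)
      f≤g⁺ : ∀ {i j} → i Fin.≤ j → f i Fin.≤ g j
      f≤g⁺ {i} {j} i≤j = adj-up⁻ (subst (Adj (4F , f i)) (g-eq j)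
        (subst (λ u → Adj u (σ (5F , j))) (f-eq i) (σ-preserves (up refl i≤j))))
      f≤g⁻ : ∀ {i j} → f i Fin.≤ g j → i Fin.≤ j
      f≤g⁻ {i} {j} fi≤gj = adj-up⁻ (σ-reflects (subst (λ u → Adj u (σ (5F , j))) (sym (f-eq i))
        (subst (Adj (4F , f i)) (sym (g-eq j)) (up refl fi≤gj))))
      mono : ∀ {i j} → i Fin.< j → f i Fin.< f j
      mono {i} {j} i<j = ℕ.≰⇒> λ fj≤fi →
        ℕ.<⇒≱ i<j (f≤g⁻ (ℕ.≤-trans fj≤fi (f≤g⁺ {i} {i} ℕ.≤-refl)))

    all-fixed : ∀ u → σ u ≡ u
    -- The induction carries two consecutive layers, since `fixed-next` also looks two layers down;
    -- it starts from layers 4 and 5.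
    all-fixed (t , j) = proj₂ (cyclic-induction (λ t → Fixed (prev t) × Fixed t)
      (λ t (P , Q) → Q , fixed-next t (P 0F) Q)
      {5F} (fixed-layer-4 , fixed-next 5F fixed-x fixed-layer-4) t) j

  rigid : Rigid
  rigid = all-fixed

  -- Spreading of missing vertices.

  module _ {S : V → Set} (tidy : Tidy S) where

    -- Otherwise the loop and the edge to `v` would both be private at `u`, and tidiness would
    -- identify `v` with `u`, although only `u` is in `S`.
    loop-spreads : ∀ {u v} → mate u ≡ u → Adj u v → ¬ S v → ¬ S u
    loop-spreads eq u~v ¬Sv Su = ¬Sv (subst S (tidy Su (loop eq) u~v (inj₁ refl) (inj₂ ¬Sv)) Su)

    two-spread : ∀ {u v w} → Adj u v → Adj u w → v ≢ w → ¬ S v → ¬ S w → ¬ S u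
    two-spread u~v u~w v≢w ¬Sv ¬Sw Su = v≢w (tidy Su u~v u~w (inj₂ ¬Sv) (inj₂ ¬Sw))

-- Tidy sets for `k ≥ 4`.

module Percolation (r n″ : ℕ) where

  open Layered r (suc n″)
  open DualSymmetry Γ using (Tidy)

  module _ {S : V → Set} (tidy : Tidy S) where

    -- All rows except row 0 are looped throughout, so a gap runs around the cycle.
    row-spreads : ∀ {i} t → ¬ S (t , suc i) → ∀ t′ → ¬ S (t′ , suc i)
    row-spreads {i} t ¬S = cyclic-induction (λ t → ¬ S (t , suc i))
      (λ t → loop-spreads tidy refl (down refl ℕ.≤-refl)) ¬S

    upper-rows-spread : ∀ {i} t → ¬ S (t , suc i) → ∀ t′ j → ¬ S (t′ , suc j)
    upper-rows-spread {i} t ¬S t′ j with Fin.≤-total i j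
    ... | inj₁ i≤j =
      loop-spreads tidy refl (down refl (s≤s i≤j)) (row-spreads t ¬S (prev t′))
    ... | inj₂ j≤i =
      loop-spreads tidy refl (up (sym (prev-next t′)) (s≤s j≤i)) (row-spreads t ¬S (next t′))

    -- In row 0 the looped `(3 , 0)` falls first, through `(4 , 1)`. From there on each `(s , 0)`
    -- has the missing neighbours `(prev s , 0)` and `(next s , 1)`, which remove it whether it is
    -- looped or not.
    upper⇒all-spread : ∀ {i} t → ¬ S (t , suc i) → ∀ v → ¬ S v
    upper⇒all-spread t ¬S (t′ , suc j) = upper-rows-spread t ¬S t′ j
    upper⇒all-spread t ¬S (t′ , zero)  = cyclic-induction (λ t → ¬ S (t , zero))
      (λ s ¬S′ → two-spread tidy (down refl z≤n) (up (sym (prev-next s)) z≤n) (λ ())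
        ¬S′ (row-1 (next s)))
      {3F} (loop-spreads tidy refl (up {t = 4F} refl z≤n) (row-1 4F)) t′
      where
      row-1 : ∀ t → ¬ S (t , suc zero)
      row-1 t″ = upper-rows-spread t ¬S t″ zero

    spreads : ∀ {u} → ¬ S u → ∀ v → ¬ S v
    spreads {t , suc i} ¬S = upper⇒all-spread t ¬S
    spreads {t , zero}  ¬S = upper⇒all-spread (next t)
      (loop-spreads tidy {next t , suc zero} refl (down (sym (prev-next t)) z≤n) ¬S)

-- Tidy sets for `k = 3`.

module Cubic (r : ℕ) where

  open Layered r 0
  open DualSymmetry Γ using (Tidy; Reflection)

  module _ {S : V → Set} (S? : Decidable S) (tidy : Tidy S) where

    At : Fin m → Set
    At t = S (t , 0F)

    _~_ : Fin m → Fin m → Set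
    s ~ t = Adj (s , 0F) (t , 0F)

    next~ : ∀ {t} → prev t ~ t
    next~ = up refl z≤n

    prev~ : ∀ {t} → t ~ prev t
    prev~ = down refl z≤n

    looped : ∀ {s t} → chord s ≡ s → s ~ t → At s → At t
    looped eq s~t Ss = decidable-stable (S? _) λ ¬St → loop-spreads tidy (cong (_, 0F) eq) s~t ¬St Ss

    one-missing : ∀ {s t t′} → s ~ t → s ~ t′ → t ≢ t′ → At s → ¬ At t → At t′
    one-missing s~t s~t′ t≢t′ Ss ¬St =
      decidable-stable (S? _) λ ¬St′ → two-spread tidy s~t s~t′ (t≢t′ ∘ cong proj₁) ¬St ¬St′ Ss

    reflection : (p : Fin m → Fin m) → (∀ {t} → At t → At (p t)) → (∀ {t} → At t → p (p t) ≡ t) →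
      (∀ t → At (prev t) → At t → p (prev t) ~ p t) →
      (∀ t → At t → At (chord t) → chord t ≢ t → p t ~ p (chord t)) →
      (∃ λ t → At t × p t ≢ t) → Reflection S
    reflection p closed invol edge chord-edge (t₀ , St₀ , pt₀≢) = record
      { π          = λ (t , _) → p t , 0F
      ; π-closed   = λ { {_ , 0F} → closed }
      ; involutive = λ { {_ , 0F} St → cong (_, 0F) (invol St) }
      ; π-adj      = adj
      ; moved      = (t₀ , 0F) , St₀ , pt₀≢ ∘ cong proj₁
      }
      where
      adj : ∀ {u v} → S u → S v → u ≢ v → Adj u v → Adj (p (proj₁ u) , 0F) (p (proj₁ v) , 0F)
      adj {_ , 0F} {t , 0F} Su Sv _ (up refl _)   = edge t Su Sv
      adj {t , 0F} {_ , 0F} Su Sv _ (down refl _) = adj-sym (edge t Sv Su)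
      adj {t , 0F} {_ , 0F} Su Sv u≢v (mates refl) =
        chord-edge t Su Sv λ eq → u≢v (cong (_, 0F) (sym eq))

    -- Every proper tidy S omits 3, 1 or the path 5, 6, …, and each of the three cases has its
    -- own reflection.
    pattern block s = suc (suc (suc (suc s)))
    pattern path s = suc (block s)

    -- The vertices from 5 on are all looped, so `S` contains the whole path or none of it.
    path-block : ∀ s → At (path s) → At 5F
    path-block = <-weakInduction (λ s → At (path s) → At 5F) id (λ s ih Ss → ih (looped refl prev~ Ss))

    block-path : At 5F → ∀ s → At (path s)
    block-path S5 = <-weakInduction (At ∘ path) S5 (λ s → looped refl next~)

    -- Without 3 there remains the cycle 0, 1, 4, 5, ... with 2 joined to 0 and 1; without 1, the
    -- cycle 0, 2, 3, 4, 5, .... Each map is the reflection of that cycle which fixes 2 and reverses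
    -- the block.
    without-3 without-1 : Fin m → Fin m
    without-3 0F = 1F
    without-3 1F = 0F
    without-3 2F = 2F
    without-3 3F = 3F
    without-3 (block s) = block (opposite s)

    without-1 0F = 3F
    without-1 1F = 1F
    without-1 2F = 2F
    without-1 3F = 0F
    without-1 (block s) = block (opposite s)

    -- Without the path there remains the square 1, 2, 3, 4 with the apex 0 over its side 12; the
    -- map is the mirror symmetry of this house.
    without-path : Fin m → Fin m
    without-path 0F = 0F
    without-path 1F = 2F
    without-path 2F = 1F
    without-path 3F = 4F
    without-path 4F = 3F
    without-path (path s) = path s

    last≡ : block (opposite (fromℕ (2 + r))) ≡ 4F
    last≡ = cong (λ s → block s) (opposite-fromℕ (2 + r))

    reversed~ : ∀ s → block (opposite (inject₁ s)) ~ block (opposite (suc s))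
    reversed~ s = down (cong (λ z → prev (block z)) (sym (opposite-inject₁ s))) z≤n

    tidy-cases : (∀ u → S u) ⊎ (∀ u → ¬ S u) ⊎ Reflection S
    tidy-cases with S? (5F , 0F)
    ... | yes S5 = with-path (S? (3F , 0F)) (S? (1F , 0F))
      where
      S4 : At 4F
      S4 = looped refl prev~ S5
      S-block : ∀ s → At (block s)
      S-block zero    = S4
      S-block (suc s) = block-path S5 s
      S0 : At 0F
      S0 = looped refl next~ (block-path S5 (fromℕ (1 + r)))
      with-path : Dec (At 3F) → Dec (At 1F) → _
      with-path (yes S3) (yes S1) = inj₁ all
        where
        all : ∀ u → S u
        all (0F , 0F) = S0
        all (1F , 0F) = S1
        all (2F , 0F) = looped refl prev~ S3
        all (3F , 0F) = S3
        all (block s , 0F) = S-block s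
      with-path (no ¬S3) _ =
        inj₂ (inj₂ (reflection without-3 closed invol edge chord-edge (0F , S0 , λ ())))
        where
        -- The neighbours of 4 are 3, 5 and the mate 1; with 3 missing, 4 can lose no other.
        S1 : At 1F
        S1 = one-missing prev~ (mates refl) (λ ()) S4 ¬S3
        closed : ∀ {t} → At t → At (without-3 t)
        closed {0F} _ = S1
        closed {1F} _ = S0
        closed {2F} St = St
        closed {3F} St = St
        closed {block s} _ = S-block (opposite s)
        invol : ∀ {t} → At t → without-3 (without-3 t) ≡ t
        invol {0F} _ = refl
        invol {1F} _ = refl
        invol {2F} _ = refl
        invol {3F} _ = refl
        invol {block s} _ = cong (λ s → block s) (Fin.opposite-involutive s)
        edge : ∀ t → At (prev t) → At t → without-3 (prev t) ~ without-3 t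
        -- The edge from the last layer to 0 goes to the chord between 4 and 1.
        edge 0F _ _ = subst (_~ 1F) (sym last≡) (mates refl)
        edge 1F _ _ = prev~
        edge 2F _ _ = mates refl
        edge 3F _ S3 = contradiction S3 ¬S3
        edge 4F S3 _ = contradiction S3 ¬S3
        edge (path s) _ _ = reversed~ s
        chord-edge : ∀ t → At t → At (chord t) → chord t ≢ t → without-3 t ~ without-3 (chord t)
        chord-edge 0F _ _ _ = next~
        chord-edge 1F _ _ _ = prev~
        chord-edge 2F _ _ _ = prev~
        chord-edge 3F _ _ ne = contradiction refl ne
        chord-edge 4F _ _ _ = next~
        chord-edge (path s) _ _ ne = contradiction refl ne
      with-path (yes S3) (no ¬S1) =
        inj₂ (inj₂ (reflection without-1 closed invol edge chord-edge (0F , S0 , λ ())))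
        where
        closed : ∀ {t} → At t → At (without-1 t)
        closed {0F} _ = S3
        closed {1F} St = St
        closed {2F} St = St
        closed {3F} _ = S0
        closed {block s} _ = S-block (opposite s)
        invol : ∀ {t} → At t → without-1 (without-1 t) ≡ t
        invol {0F} _ = refl
        invol {1F} _ = refl
        invol {2F} _ = refl
        invol {3F} _ = refl
        invol {block s} _ = cong (λ s → block s) (Fin.opposite-involutive s)
        edge : ∀ t → At (prev t) → At t → without-1 (prev t) ~ without-1 t
        -- Here the edge from the last layer to 0 goes to the layer edge between 4 and 3.
        edge 0F _ _ = subst (_~ 3F) (sym last≡) prev~
        edge 1F _ S1 = contradiction S1 ¬S1
        edge 2F S1 _ = contradiction S1 ¬S1
        edge 3F _ _ = mates refl
        edge 4F _ _ = prev~
        edge (path s) _ _ = reversed~ s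
        chord-edge : ∀ t → At t → At (chord t) → chord t ≢ t → without-1 t ~ without-1 (chord t)
        chord-edge 0F _ _ _ = prev~
        chord-edge 1F S1 _ _ = contradiction S1 ¬S1
        chord-edge 2F _ _ _ = next~
        chord-edge 3F _ _ ne = contradiction refl ne
        chord-edge 4F _ S1 _ = contradiction S1 ¬S1
        chord-edge (path s) _ _ ne = contradiction refl ne
    ... | no ¬S5 = without-path-cases (S? (1F , 0F))
      where
      ¬path : ∀ s → ¬ At (path s)
      ¬path s Ss = ¬S5 (path-block s Ss)
      4⇒3 : At 4F → At 3F
      4⇒3 S4 = one-missing next~ prev~ (λ ()) S4 ¬S5
      4⇒1 : At 4F → At 1F
      4⇒1 S4 = one-missing next~ (mates refl) (λ ()) S4 ¬S5
      3⇒4 : At 3F → At 4F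
      3⇒4 = looped refl next~
      0⇒1 : At 0F → At 1F
      0⇒1 S0 = one-missing prev~ next~ (λ ()) S0 (¬path (fromℕ (1 + r)))
      0⇒2 : At 0F → At 2F
      0⇒2 S0 = one-missing prev~ (mates refl) (λ ()) S0 (¬path (fromℕ (1 + r)))
      without-path-cases : Dec (At 1F) → _
      without-path-cases (no ¬S1) = inj₂ (inj₁ none)
        where
        none : ∀ u → ¬ S u
        none (0F , 0F) = ¬S1 ∘ 0⇒1
        none (1F , 0F) = ¬S1
        -- With 1 missing, 2 would keep 3, hence 4, hence 1.
        none (2F , 0F) S2 = ¬S1 (4⇒1 (3⇒4 (one-missing prev~ next~ (λ ()) S2 ¬S1)))
        none (3F , 0F) = ¬S1 ∘ 4⇒1 ∘ 3⇒4
        none (4F , 0F) = ¬S1 ∘ 4⇒1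
        none (path s , 0F) = ¬path s
      without-path-cases (yes S1) =
        inj₂ (inj₂ (reflection without-path closed invol edge chord-edge (1F , S1 , λ ())))
        where
        -- If 2 were missing, 1 would keep its neighbour 0; but 0 has already lost the last layer,
        -- so it would keep 2.
        S2 : At 2F
        S2 = decidable-stable (S? _) λ ¬S2 → ¬S2 (0⇒2 (one-missing next~ prev~ (λ ()) S1 ¬S2))
        closed : ∀ {t} → At t → At (without-path t)
        closed {0F} S0 = S0
        closed {1F} _ = S2
        closed {2F} _ = S1
        closed {3F} = 3⇒4
        closed {4F} = 4⇒3
        closed {path s} Ss = Ss
        invol : ∀ {t} → At t → without-path (without-path t) ≡ t
        invol {0F} _ = refl
        invol {1F} _ = refl
        invol {2F} _ = refl
        invol {3F} _ = refl
        invol {4F} _ = refl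
        invol {path s} _ = refl
        edge : ∀ t → At (prev t) → At t → without-path (prev t) ~ without-path t
        edge 0F Ss _ = contradiction Ss (¬path (fromℕ (1 + r)))
        edge 1F _ _ = mates refl
        edge 2F _ _ = prev~
        edge 3F _ _ = mates refl
        edge 4F _ _ = prev~
        edge (path s) _ Ss = contradiction Ss (¬path s)
        chord-edge : ∀ t → At t → At (chord t) → chord t ≢ t → without-path t ~ without-path (chord t)
        chord-edge 0F _ _ _ = next~
        chord-edge 1F _ _ _ = next~
        chord-edge 2F _ _ _ = prev~
        chord-edge 3F _ _ ne = contradiction refl ne
        chord-edge 4F _ _ _ = prev~
        chord-edge (path s) _ _ ne = contradiction refl ne

-- The infinite family.

tidy-cases : ∀ r n′ {S} → Decidable S → DualSymmetry.Tidy (Layered.Γ r n′) S →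
             (∀ u → S u) ⊎ (∀ u → ¬ S u) ⊎ DualSymmetry.Reflection (Layered.Γ r n′) S
tidy-cases r zero S? tidy = Cubic.tidy-cases r S? tidy
tidy-cases r (suc n″) S? tidy with Dual.anyᵥ? (Layered.Γ r (suc n″)) (λ u → ¬? (S? u))
... | yes (_ , ¬S) = inj₂ (inj₁ (Percolation.spreads r n″ tidy ¬S))
... | no all = inj₁ λ u → decidable-stable (S? u) λ ¬S → all (u , ¬S)

theorem2 : (k : ℕ) → k ≥ 3 →
    Σ (ℕ → KGraph k) λ G →
    (∀ i → MinimalAsymmetric (G i) × KGraph.maxDegree (G i) ≡ 2 × KGraph.maxCodegree (G i) ≡ 1) ×
    (∀ i j → i ≢ j → ¬ Isomorphic (G i) (G j))
theorem2 (suc (suc (suc n′))) (s≤s (s≤s (s≤s z≤n))) =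
    (λ r → Dual.G (Layered.Γ r n′))
  , (λ r → DualSymmetry.minimalAsymmetric (Layered.Γ r n′) (Layered.rigid r n′) (tidy-cases r n′)
         , Dual.maxDegree≡2 (Layered.Γ r n′) (zero , zero)
         , Dual.maxCodegree≡1 (Layered.Γ r n′) (zero , zero))
  -- The number `(7 + r) * suc n′` of hyperedges is invariant under isomorphism and determines `r`.
  , (λ r r′ r≢r′ iso → r≢r′ (ℕ.+-cancelˡ-≡ 7 r r′ (ℕ.*-cancelʳ-≡ (7 + r) (7 + r′) (suc n′)
      (isomorphic⇒N≡N (Layered.Γ r n′) (Layered.Γ r′ n′) iso))))
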